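{- Let $k\geq 13$ be a positive integer. Let $A$ be a set of $k$ integers such that $\min(A)=0$, $\gcd(A)=1$, and $|3^{\wedge}A| = 3k-5$. Then $A=[0,k+2]\setminus\{x,y,z\}$, where $\{x,y,z\}$ is one of the sets $\{1,2,3\}$, $\{k-1,k,k+1\}$, $\{1,2,k+1\}$, $\{1,k,k+1\}$, $\{1,3,k+2\}$, $\{k-2,k,k+2\}$, $\{1,4,k+2\}$, $\{k-3,k,k+2\}$, $\{2,k,k+2\}$, $\{1,k-1,k+2\}$, $\{1,k-2,k+2\}$, $\{3,k,k+2\}$, or $\{r,k+1,k+2\}$ with $4\leq r\leq k-4$.
   Context: For a finite set $A$ of integers and a positive integer $h\le |A|$, the restricted $h$-fold sumset $h^{\wedge}A$ is the set of all sums of $h$ distinct elements of $A$. For integers $\alpha\le\beta$, $[\alpha,\beta]=\{x\in\mathbb{Z}:\alpha\le x\le\beta\}$. $\gcd(A)$ denotes the greatest common divisor of the elements of $A$. -}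

module Defs where

open import Data.Nat as ℕ using (ℕ)
open import Data.Integer using (ℤ; +_; _+_; _-_; _≤_)
open import Data.Integer.GCD using (gcd)
open import Data.List using (List; foldr; length)
open import Data.List.Membership.Propositional using (_∈_)
open import Data.List.Relation.Unary.Unique.Propositional using (Unique)
open import Data.List.Relation.Unary.All using (All)
open import Data.Product using (Σ; ∃; _×_; _,_)
open import Data.Sum using (_⊎_)
open import Relation.Binary.PropositionalEquality using (_≡_; _≢_)
open import Relation.Nullary using (¬_)
open import Function.Bundles using (_⇔_)

-- A finite set of integers is represented by a duplicate-free list.

gcdList : List ℤ → ℤ
gcdList = foldr gcd (+ 0)

MinIsZero : List ℤ → Set
MinIsZero A = (+ 0 ∈ A) × All (λ a → + 0 ≤ a) A

InRestricted3Sum : List ℤ → ℤ → Set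
InRestricted3Sum A s =
  Σ ℤ λ a → Σ ℤ λ b → Σ ℤ λ c →
    (a ∈ A) × (b ∈ A) × (c ∈ A) × (a ≢ b) × (a ≢ c) × (b ≢ c) × (s ≡ a + b + c)

Restricted3SumCard : List ℤ → ℕ → Set
Restricted3SumCard A n =
  Σ (List ℤ) λ L → Unique L × (length L ≡ n) × (∀ s → (s ∈ L) ⇔ InRestricted3Sum A s)

IsIntervalMinus3 : List ℤ → ℤ → ℤ → ℤ → ℤ → Set
IsIntervalMinus3 A m x y z =
  ∀ t → (t ∈ A) ⇔ ((+ 0 ≤ t) × (t ≤ m) × (t ≢ x) × (t ≢ y) × (t ≢ z))

ExceptionalTriple : ℕ → ℤ → ℤ → ℤ → Set
ExceptionalTriple k x y z =
     T (+ 1) (+ 2) (+ 3)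
   ⊎ T (K - + 1) K (K + + 1)
   ⊎ T (+ 1) (+ 2) (K + + 1)
   ⊎ T (+ 1) K (K + + 1)
   ⊎ T (+ 1) (+ 3) (K + + 2)
   ⊎ T (K - + 2) K (K + + 2)
   ⊎ T (+ 1) (+ 4) (K + + 2)
   ⊎ T (K - + 3) K (K + + 2)
   ⊎ T (+ 2) K (K + + 2)
   ⊎ T (+ 1) (K - + 1) (K + + 2)
   ⊎ T (+ 1) (K - + 2) (K + + 2)
   ⊎ T (+ 3) K (K + + 2)
   ⊎ (Σ ℤ λ r → (+ 4 ≤ r) × (r ≤ K - + 4) × T r (K + + 1) (K + + 2))
  where
    K : ℤ
    K = + k
    T : ℤ → ℤ → ℤ → Set
    T a b c = (x ≡ a) × (y ≡ b) × (z ≡ c)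

{-# OPTIONS --safe #-}

-- Let e(A) = |3^A| - (3|A| - 8), so that e(A) ≤ 3 here. If the last three elements of a block L are
-- the first three of a block R, then 3^L and 3^R share only one sum, whence e(L ∪ R) ≥ e(L) + e(R).
-- Four blocks of five consecutive elements overlapping in this way cannot all have e ≥ 1, and five
-- elements with e = 0 form a progression, say of difference d. Starting from it, the next gap can only
-- be one of finitely many multiples of d (otherwise e > 3), so gcd(A) = 1 gives d = 1 and A is a run of
-- consecutive integers with one of finitely many irregular ends on either side. Cutting in the run, the
-- excesses of the two ends add up to at most 3, which leaves 24 pairs of ends. Of these, 10 have e ≤ 2:
-- their 3-sums are too few. The other 14 give the exceptional sets.
-- Lower bounds for e with unknown gaps are obtained by computing with the 3-sums as linear forms in
-- positive unknowns, compared coefficientwise.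

module Submission where

open import Defs
open import Data.Bool using (Bool; true; false; T; _∧_; _∨_; if_then_else_)
open import Data.Bool.ListAction using (all)
open import Data.Bool.Properties using (T-∧; T-∨; T-≡)
open import Data.Empty using (⊥; ⊥-elim)
open import Data.Integer as ℤ using (ℤ; ∣_∣)
import Data.Integer.Properties as ℤ
open import Data.Integer.GCD using (gcd-greatest)
open import Data.List
  using (List; []; _∷_; [_]; _++_; map; length; reverse; replicate; filter; applyUpTo; upTo)
import Data.List.Membership.DecPropositional as DecMembership
open import Data.List.Membership.Propositional using (_∈_)
open import Data.List.Membership.Propositional.Properties
  using (∈-∃++; ∈-++⁺ˡ; ∈-++⁺ʳ; ∈-++⁻; ∈-filter⁺; ∈-filter⁻; ∈-applyUpTo⁺; ∈-applyUpTo⁻; ∈-upTo⁺;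
    ∈-map⁺; ∈-map⁻)
open import Data.List.Properties
  using (≡-dec; ++-assoc; ++-identityʳ; length-++; length-applyUpTo; length-map;
    length-replicate; length-reverse; map-++; map-∘; map-cong; map-id; reverse-++;
    reverse-involutive; reverse-map; unfold-reverse)
open import Data.List.Relation.Binary.Permutation.Propositional using (_↭_; ↭-sym; ↭⇒↭ₛ)
open import Data.List.Relation.Binary.Permutation.Propositional.Properties
  using (↭-reverse; ↭-length; ∈-resp-↭; All-resp-↭)
import Data.List.Relation.Binary.Permutation.Setoid.Properties as Permutation
open import Data.List.Relation.Unary.All as All using (All; []; _∷_)
import Data.List.Relation.Unary.All.Properties as All
open import Data.List.Relation.Unary.AllPairs as AllPairs using (AllPairs; []; _∷_)
open import Data.List.Relation.Unary.Any using (here; there)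
open import Data.List.Relation.Unary.Linked using (Linked; []; [-]; _∷_)
open import Data.List.Relation.Unary.Linked.Properties using (Linked⇒AllPairs)
open import Data.List.Relation.Unary.Unique.Propositional using (Unique)
import Data.List.Relation.Unary.Unique.Propositional.Properties as Unique
open import Data.Nat as ℕ
  using (ℕ; zero; suc; _+_; _*_; _∸_; _/_; _%_; _≤_; _<_; _≤ᵇ_; _<ᵇ_; _≡ᵇ_; _<?_; z≤n; s≤s;
    >-nonZero)
open import Data.Nat.Divisibility using (_∣_; _∣0; n∣m*n; ∣m∣n⇒∣m+n; ∣1⇒≡1)
open import Data.Nat.DivMod using (m≡m%n+[m/n]*n; m%n<n)
open import Data.Nat.ListAction using (sum)
open import Data.Nat.ListAction.Properties using (sum-++; sum-↭)
open import Data.Nat.Properties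
open import Data.List.Sort ≤-decTotalOrder using (sort; sort-↭; sort-↗)
open import Data.Nat.Tactic.RingSolver using (solve-∀)
open import Data.Product using (Σ; ∃; ∃₂; _×_; _,_; proj₁; proj₂)
import Data.Product.Properties as Product
open import Data.Sum using (_⊎_; inj₁; inj₂)
open import Data.Vec as Vec using (Vec; []; _∷_)
open import Data.Vec.Relation.Unary.All as VAll using ([]; _∷_)
open import Function using (_∘_)
open import Function.Bundles using (Equivalence; _⇔_; mk⇔)
open import Relation.Binary using (tri<; tri≈; tri>)
open import Relation.Binary.PropositionalEquality
  using (_≡_; _≢_; refl; sym; trans; cong; cong₂; subst; subst₂; setoid; module ≡-Reasoning)
open import Relation.Nullary using (¬_; Dec; yes; no; does; contradiction)
open import Relation.Nullary.Decidable using (True; toWitness)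

-- The single sum common to two overlapping blocks is that of their three shared elements: it is the
-- greatest 3-sum of `L` and the least of `R`. As |L| + |R| = |A| + 3, the base values satisfy (3|L|
-- - 8) + (3|R| - 8) - 1 = 3|A| - 8, so a cut loses nothing. The obstacle is that an irregularity
-- may lie anywhere in the set, which leaves infinitely many words. Only one shape does this: an
-- isolated hole with five consecutive elements on one side and four on the other already has excess
-- 3, so a cut behind it leaves excess 0 and everything beyond is regular. All other irregularities
-- stop after at most three gaps, and a finite search finds them.

private variable
  A B : Set

-- Counting with duplicate-free lists.

unique-⊆-length : {xs ys : List A} → Unique xs → (∀ {x} → x ∈ xs → x ∈ ys) → length xs ≤ length ys
unique-⊆-length [] _ = z≤n
unique-⊆-length {xs = x ∷ xs} (x≢ ∷ u) sub with ∈-∃++ (sub (here refl))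
... | ps , qs , refl = ≤-trans (s≤s (unique-⊆-length u sub′)) (≤-reflexive eq)
  where
  sub′ : ∀ {y} → y ∈ xs → y ∈ ps ++ qs
  sub′ y∈xs with ∈-++⁻ ps (sub (there y∈xs))
  ... | inj₁ y∈ps = ∈-++⁺ˡ y∈ps
  ... | inj₂ (here y≡x) = contradiction (sym y≡x) (All.lookup x≢ y∈xs)
  ... | inj₂ (there y∈qs) = ∈-++⁺ʳ ps y∈qs
  eq : suc (length (ps ++ qs)) ≡ length (ps ++ [ x ] ++ qs)
  eq = trans (cong suc (length-++ ps)) (trans (sym (+-suc _ _)) (sym (length-++ ps)))

unique-map : {xs : List A} {f : A → B} → (∀ {x y} → x ∈ xs → y ∈ xs → f x ≡ f y → x ≡ y) →
  Unique xs → Unique (map f xs)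
unique-map inj [] = []
unique-map inj (x≢ ∷ u) =
  All.map⁺ (All.tabulate λ y∈ eq → All.lookup x≢ y∈ (inj (here refl) (there y∈) eq))
  ∷ unique-map (λ x∈ y∈ → inj (there x∈) (there y∈)) u

-- Gap words, their points, and bounds for their 3-sums.

-- A set with minimum s is encoded by the word of its successive gaps.
pts : ℕ → List ℕ → List ℕ
pts s []      = s ∷ []
pts s (g ∷ w) = s ∷ pts (s + g) w

pts-≥ : ∀ {s} w {t} → t ∈ pts s w → s ≤ t
pts-≥ []      (here refl) = ≤-refl
pts-≥ (g ∷ w) (here refl) = ≤-refl
pts-≥ {s} (g ∷ w) (there t∈) = ≤-trans (m≤m+n s g) (pts-≥ w t∈)

pts-prefix : ∀ {s} w {t} → t ∈ pts s w → ∃₂ λ u v → w ≡ u ++ v × t ≡ s + sum u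
pts-prefix [] (here refl) = [] , [] , refl , sym (+-identityʳ _)
pts-prefix (g ∷ w) (here refl) = [] , g ∷ w , refl , sym (+-identityʳ _)
pts-prefix {s} (g ∷ w) (there t∈) with pts-prefix w t∈
... | u , v , refl , refl = g ∷ u , v , refl , +-assoc s g (sum u)

prefix-pts : ∀ s u v → s + sum u ∈ pts s (u ++ v)
prefix-pts s [] [] = here (+-identityʳ s)
prefix-pts s [] (g ∷ v) = here (+-identityʳ s)
prefix-pts s (g ∷ u) v = there (subst (_∈ pts (s + g) (u ++ v)) (+-assoc s g (sum u))
    (prefix-pts (s + g) u v))

pts-shift : ∀ q s w {t} → t ∈ pts s w → q + t ∈ pts (q + s) w
pts-shift q s [] (here refl) = here refl
pts-shift q s (g ∷ w) (here refl) = here refl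
pts-shift q s (g ∷ w) {t} (there t∈) =
  there (subst (λ p → q + t ∈ pts p w) (sym (+-assoc q s g)) (pts-shift q (s + g) w t∈))

pts-++ʳ : ∀ s u v {t} → t ∈ pts (s + sum u) v → t ∈ pts s (u ++ v)
pts-++ʳ s [] v {t} t∈ = subst (λ p → t ∈ pts p v) (+-identityʳ s) t∈
pts-++ʳ s (g ∷ u) v {t} t∈ =
  there (pts-++ʳ (s + g) u v (subst (λ p → t ∈ pts p v) (sym (+-assoc s g (sum u))) t∈))

pts-++ˡ : ∀ s u v {t} → t ∈ pts s u → t ∈ pts s (u ++ v)
pts-++ˡ s [] [] t∈ = t∈
pts-++ˡ s [] (g ∷ v) (here refl) = here refl
pts-++ˡ s (g ∷ u) v (here refl) = here refl
pts-++ˡ s (g ∷ u) v (there t∈) = there (pts-++ˡ (s + g) u v t∈)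

pts-increasing : ∀ {s w} → All (0 <_) w → AllPairs _<_ (pts s w)
pts-increasing [] = [] ∷ []
pts-increasing {s} {g ∷ w} (g>0 ∷ pos) =
  All.tabulate (λ t∈ → ≤-trans (m<m+n s g>0) (pts-≥ w t∈)) ∷ pts-increasing pos

Sum3 : List ℕ → ℕ → Set
Sum3 P s = ∃ λ x → ∃ λ y → ∃ λ z → x ∈ P × y ∈ P × z ∈ P × x < y × y < z × s ≡ x + (y + z)

sum3-map : ∀ {P Q s} → (∀ {t} → t ∈ P → t ∈ Q) → Sum3 P s → Sum3 Q s
sum3-map f (x , y , z , x∈ , y∈ , z∈ , rest) = x , y , z , f x∈ , f y∈ , f z∈ , rest

sum3-shift : ∀ q w {s} → Sum3 (pts 0 w) s → Sum3 (pts q w) (3 * q + s)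
sum3-shift q w (x , y , z , x∈ , y∈ , z∈ , x<y , y<z , refl) =
  q + x , q + y , q + z , move x∈ , move y∈ , move z∈ ,
  +-monoʳ-< q x<y , +-monoʳ-< q y<z , lemma q x y z
  where
  move : ∀ {t} → t ∈ pts 0 w → q + t ∈ pts q w
  move {t} t∈ = subst (λ p → q + t ∈ pts p w) (+-identityʳ q) (pts-shift q 0 w t∈)
  lemma : ∀ q x y z → 3 * q + (x + (y + z)) ≡ q + x + (q + y + (q + z))
  lemma = solve-∀

-- The least 3-sum, with junk value 0 if there are fewer than three points.
low : List ℕ → ℕ
low (a ∷ b ∷ _) = a + (a + b)
low _           = 0

low-≤ : ∀ w {s} → Sum3 (pts 0 w) s → low w ≤ s
low-≤ [] _ = z≤n
low-≤ (_ ∷ []) _ = z≤n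
low-≤ (a ∷ b ∷ w) (x , y , z , x∈ , here refl , z∈ , () , y<z , refl)
low-≤ (a ∷ b ∷ w) (x , y , z , x∈ , there y∈ , here refl , x<y , () , refl)
low-≤ (a ∷ b ∷ w) (x , y , z , x∈ , there y∈ , there (here refl) , x<y , y<z , refl) =
  contradiction (pts-≥ (b ∷ w) y∈) (<⇒≱ y<z)
low-≤ (a ∷ b ∷ w) (x , y , z , x∈ , there y∈ , there (there z∈) , x<y , y<z , refl) =
  ≤-trans (+-mono-≤ (pts-≥ (b ∷ w) y∈) (pts-≥ w z∈)) (m≤n+m _ x)

-- The reversed word encodes the mirror image of the set under `t ↦ sum w - t`. This is how every
-- result about one end is transferred to the other.
pts-reverse : ∀ w {t} → t ∈ pts 0 (reverse w) → ∃ λ t′ → t′ ∈ pts 0 w × t + t′ ≡ sum w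
pts-reverse w t∈ with pts-prefix (reverse w) t∈
... | u , v , eq , refl = sum (reverse v) , subst (λ x → sum (reverse v) ∈ pts 0 x) (sym w≡)
    (prefix-pts 0 (reverse v) (reverse u)) ,
  (begin
    sum u + sum (reverse v)           ≡⟨ cong₂ _+_ (sym (sum-↭ (↭-reverse u))) refl ⟩
    sum (reverse u) + sum (reverse v) ≡⟨ +-comm (sum (reverse u)) _ ⟩
    sum (reverse v) + sum (reverse u) ≡⟨ sum-++ (reverse v) (reverse u) ⟨
    sum (reverse v ++ reverse u)      ≡⟨ cong sum w≡ ⟨
    sum w ∎)
  where
  open ≡-Reasoning
  w≡ : w ≡ reverse v ++ reverse u
  w≡ = trans (sym (reverse-involutive w)) (trans (cong reverse eq) (reverse-++ u v))

sum3-reverse : ∀ w {s} → Sum3 (pts 0 (reverse w)) s → ∃ λ s′ → Sum3 (pts 0 w) s′ × s + s′ ≡ 3 * sum w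
sum3-reverse w (x , y , z , x∈ , y∈ , z∈ , x<y , y<z , refl)
  with x′ , x′∈ , x≡ ← pts-reverse w x∈
     | y′ , y′∈ , y≡ ← pts-reverse w y∈
     | z′ , z′∈ , z≡ ← pts-reverse w z∈ =
  z′ + (y′ + x′) ,
  (z′ , y′ , x′ , z′∈ , y′∈ , x′∈ , flip (trans z≡ (sym y≡)) y<z , flip (trans y≡ (sym x≡)) x<y , refl) ,
  trans (regroup x y z x′ y′ z′) (cong₂ _+_ x≡ (cong₂ _+_ y≡ (trans z≡ (sym (+-identityʳ _)))))
  where
  flip : ∀ {a a′ b b′} → a + a′ ≡ b + b′ → b < a → a′ < b′
  flip {a} {a′} {b} {b′} eq b<a =
    +-cancelˡ-< b a′ b′ (≤-trans (+-monoˡ-< a′ b<a) (≤-reflexive eq))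
  regroup : ∀ x y z x′ y′ z′ → x + (y + z) + (z′ + (y′ + x′)) ≡ (x + x′) + ((y + y′) + (z + z′))
  regroup = solve-∀

-- The greatest 3-sum mirrors the least one of the reflected set.
sum3-≤ : ∀ w {s} → Sum3 (pts 0 w) s → s + low (reverse w) ≤ 3 * sum w
sum3-≤ w {s} S with sum3-reverse (reverse w) (subst (λ v → Sum3 (pts 0 v) s) (sym (reverse-involutive w)) S)
... | s′ , S′ , eq = ≤-trans (+-monoʳ-≤ s (low-≤ (reverse w) S′))
  (≤-reflexive (trans eq (cong (3 *_) (sum-↭ (↭-reverse w)))))

-- Excess: reflection and superadditivity.

-- A word w encodes 1 + length w points, and 3 length w − 5 is the least possible number of 3-sums.
record Excess≤ (n : ℕ) (w : List ℕ) : Set where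
  constructor excess≤
  field
    positive : All (0 <_) w
    bound    : ∀ l → Unique l → All (Sum3 (pts 0 w)) l → length l + 5 ≤ 3 * length w + n
open Excess≤

reflect-sums : ∀ w l → Unique l → All (Sum3 (pts 0 (reverse w))) l →
  ∃ λ l′ → length l′ ≡ length l × Unique l′ × All (Sum3 (pts 0 w)) l′
reflect-sums w l uniq S = map (3 * sum w ∸_) l , length-map _ l ,
  unique-map (λ x∈ y∈ → ∸-cancelˡ-≡ (below (All.lookup S x∈)) (below (All.lookup S y∈))) uniq ,
  All.map⁺ (All.map image S)
  where
  below : ∀ {s} → Sum3 (pts 0 (reverse w)) s → s ≤ 3 * sum w
  below {s} S with s′ , _ , eq ← sum3-reverse w S = ≤-trans (m≤m+n s s′) (≤-reflexive eq)
  image : ∀ {s} → Sum3 (pts 0 (reverse w)) s → Sum3 (pts 0 w) (3 * sum w ∸ s)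
  image {s} S with s′ , S′ , eq ← sum3-reverse w S =
    subst (Sum3 (pts 0 w)) (trans (sym (m+n∸m≡n s s′)) (cong (_∸ s) eq)) S′

excess-reverse : ∀ {n} w → Excess≤ n w → Excess≤ n (reverse w)
excess-reverse {n} w e = excess≤ (All-resp-↭ (↭-sym (↭-reverse w)) (positive e)) λ l uniq S →
  let l′ , len , uniq′ , S′ = reflect-sums w l uniq S in
  subst₂ (λ a b → a + 5 ≤ 3 * b + n) len (sym (length-reverse w)) (bound e l′ uniq′ S′)

-- The 3-sums of the points of f ++ [a, b] do not exceed those of the points of a ∷ b ∷ y
-- (in their places in f ++ a ∷ b ∷ y), and at most one sum is common: the excess is superadditive.
excess-cut : ∀ f a b y {n j} l → Unique l → All (Sum3 (pts 0 (f ++ a ∷ b ∷ []))) l →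
  3 * length (f ++ a ∷ b ∷ []) + j ≤ length l + 5 →
  Excess≤ n (f ++ a ∷ b ∷ y) → Excess≤ (n ∸ j) (a ∷ b ∷ y)
excess-cut f a b y {n} {j} l uniq S long e = excess≤ (All.++⁻ʳ f (positive e)) bd
  where
  q M : ℕ
  q = sum f
  -- The sum of the three shared points `q`, `q + a` and `q + a + b`.
  M = 3 * q + (a + (a + b))
  left≤M : ∀ {s} → s ∈ l → s ≤ M
  left≤M {s} s∈ = +-cancelʳ-≤ (b + (b + a)) s M (≤-trans
    (subst (λ r → s + low r ≤ 3 * sum (f ++ a ∷ b ∷ [])) (reverse-++ f (a ∷ b ∷ []))
      (sum3-≤ (f ++ a ∷ b ∷ []) (All.lookup S s∈)))
    (≤-reflexive (trans (cong (3 *_) (sum-++ f (a ∷ b ∷ []))) (arith q a b))))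
    where
    arith : ∀ q a b → 3 * (q + (a + (b + 0))) ≡ 3 * q + (a + (a + b)) + (b + (b + a))
    arith = solve-∀
  bd : ∀ r → Unique r → All (Sum3 (pts 0 (a ∷ b ∷ y))) r → length r + 5 ≤ 3 * length (a ∷ b ∷ y) + (n ∸ j)
  bd r uniq-r R = conclude
    (≤-trans (≤-reflexive (cong (_+ 5) (sym (length-++ l))))
      (bound e (l ++ above) (Unique.++⁺ uniq (Unique.filter⁺ (M <?_)
          (unique-map (λ _ _ → +-cancelˡ-≡ (3 * q) _ _) uniq-r)) disjoint)
        (All.++⁺ (All.map (sum3-map embedˡ) S) (All.filter⁺ (M <?_) (All.map⁺ (All.map embedʳ R))))))
    where
    r′ above : List ℕ
    r′ = map (3 * q +_) r
    above = filter (M <?_) r′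
    disjoint : ∀ {s} → s ∈ l × s ∈ above → ⊥
    disjoint (s∈l , s∈above) = <⇒≱ (proj₂ (∈-filter⁻ (M <?_) {xs = r′} s∈above)) (left≤M s∈l)
    embedˡ : ∀ {t} → t ∈ pts 0 (f ++ a ∷ b ∷ []) → t ∈ pts 0 (f ++ a ∷ b ∷ y)
    embedˡ {t} t∈ = subst (λ w → t ∈ pts 0 w) (++-assoc f (a ∷ b ∷ []) y) (pts-++ˡ 0 (f ++ a ∷ b ∷ []) y t∈)
    embedʳ : ∀ {s} → Sum3 (pts 0 (a ∷ b ∷ y)) s → Sum3 (pts 0 (f ++ a ∷ b ∷ y)) (3 * q + s)
    embedʳ = sum3-map (pts-++ʳ 0 f (a ∷ b ∷ y)) ∘ sum3-shift q (a ∷ b ∷ y)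
    r′⊆ : ∀ {s} → s ∈ r′ → s ∈ M ∷ above
    r′⊆ s∈ with ∈-map⁻ (3 * q +_) s∈
    ... | s₀ , s₀∈ , refl with m≤n⇒m<n∨m≡n (+-monoʳ-≤ (3 * q) (low-≤ (a ∷ b ∷ y) (All.lookup R s₀∈)))
    ... | inj₁ M<s = there (∈-filter⁺ (M <?_) s∈ M<s)
    ... | inj₂ M≡s = here (sym M≡s)
    r≤ : length r ≤ suc (length above)
    r≤ = ≤-trans (≤-reflexive (sym (length-map (3 * q +_) r)))
      (unique-⊆-length (unique-map (λ _ _ → +-cancelˡ-≡ (3 * q) _ _) uniq-r) r′⊆)
    conclude : length l + length above + 5 ≤ 3 * length (f ++ a ∷ b ∷ y) + n →
      length r + 5 ≤ 3 * length (a ∷ b ∷ y) + (n ∸ j)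
    conclude h = ≤-trans (m+n≤o⇒m≤o∸n (length r + 5) j-le) (+-∸-≤ (3 * length (a ∷ b ∷ y)))
      where
      open ≤-Reasoning
      +-∸-≤ : ∀ m → m + n ∸ j ≤ m + (n ∸ j)
      +-∸-≤ m = m≤n+o⇒m∸n≤o (m + n) j (≤-trans (+-monoʳ-≤ m (m≤n+m∸n n j)) (≤-reflexive (swap m j (n ∸ j))))
        where
        swap : ∀ m j o → m + (j + o) ≡ j + (m + o)
        swap = solve-∀
      len : ∀ z → length (f ++ z) ≡ length f + length z
      len z = length-++ f
      j-le : length r + 5 + j ≤ 3 * length (a ∷ b ∷ y) + n
      -- The two shared gaps are counted twice, which adds 6 on the right. On the left the second
      -- constant 5 and the one shared sum add the same 6.
      j-le = +-cancelˡ-≤ (3 * (length f + 2)) _ _ (begin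
        3 * (length f + 2) + (length r + 5 + j)  ≡⟨ cong (λ z → 3 * z + _) (sym (len (a ∷ b ∷ []))) ⟩
        3 * length (f ++ a ∷ b ∷ []) + (length r + 5 + j) ≡⟨ sh (3 * length (f ++ a ∷ b ∷ []))
            (length r + 5) j ⟩
        3 * length (f ++ a ∷ b ∷ []) + j + (length r + 5)  ≤⟨ +-mono-≤ long (+-monoˡ-≤ 5 r≤) ⟩
        length l + 5 + (suc (length above) + 5)  ≡⟨ sh2 (length l) (length above) ⟩
        length l + length above + 5 + 6          ≤⟨ +-monoˡ-≤ 6 h ⟩
        3 * length (f ++ a ∷ b ∷ y) + n + 6      ≡⟨ cong (λ z → 3 * z + n + 6) (len (a ∷ b ∷ y)) ⟩
        3 * (length f + length (a ∷ b ∷ y)) + n + 6  ≡⟨ sh3 (length f) (length (a ∷ b ∷ y)) n ⟩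
        3 * (length f + 2) + (3 * length (a ∷ b ∷ y) + n) ∎)
        where
        sh : ∀ x y z → x + (y + z) ≡ x + z + y
        sh = solve-∀
        sh2 : ∀ x y → x + 5 + (suc y + 5) ≡ x + y + 5 + 6
        sh2 = solve-∀
        sh3 : ∀ x y z → 3 * (x + y) + z + 6 ≡ 3 * (x + 2) + (3 * y + z)
        sh3 = solve-∀

-- Computing 3-sums as linear forms.

pairSums : (A → A → A) → List A → List A
pairSums _⊕_ []       = []
pairSums _⊕_ (x ∷ xs) = map (x ⊕_) xs ++ pairSums _⊕_ xs

tripleSums : (A → A → A) → List A → List A
tripleSums _⊕_ []       = []
tripleSums _⊕_ (x ∷ xs) = map (x ⊕_) (pairSums _⊕_ xs) ++ tripleSums _⊕_ xs

module _ {_⊕_ : A → A → A} {_⊞_ : B → B → B} (h : A → B) (hom : ∀ x y → h (x ⊕ y) ≡ h x ⊞ h y) where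

  private
    map-translate : ∀ x ys → map h (map (x ⊕_) ys) ≡ map (h x ⊞_) (map h ys)
    map-translate x ys = trans (sym (map-∘ ys)) (trans (map-cong (hom x) ys) (map-∘ ys))

  map-pairSums : ∀ xs → map h (pairSums _⊕_ xs) ≡ pairSums _⊞_ (map h xs)
  map-pairSums [] = refl
  map-pairSums (x ∷ xs) = trans (map-++ h (map (x ⊕_) xs) _) (cong₂ _++_ (map-translate x xs)
      (map-pairSums xs))

  map-tripleSums : ∀ xs → map h (tripleSums _⊕_ xs) ≡ tripleSums _⊞_ (map h xs)
  map-tripleSums [] = refl
  map-tripleSums (x ∷ xs) = trans (map-++ h (map (x ⊕_) (pairSums _⊕_ xs)) _)
    (cong₂ _++_ (trans (map-translate x _) (cong (map (h x ⊞_)) (map-pairSums xs))) (map-tripleSums xs))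

Sum2 : List ℕ → ℕ → Set
Sum2 P s = ∃ λ y → ∃ λ z → y ∈ P × z ∈ P × y < z × s ≡ y + z

pairSums-sound : ∀ {P} → AllPairs _<_ P → All (Sum2 P) (pairSums _+_ P)
pairSums-sound [] = []
pairSums-sound (x< ∷ inc) = All.++⁺
  (All.map⁺ (All.tabulate λ z∈ → _ , _ , here refl , there z∈ , All.lookup x< z∈ , refl))
  (All.map (λ (y , z , y∈ , z∈ , rest) → y , z , there y∈ , there z∈ , rest) (pairSums-sound inc))

tripleSums-sound : ∀ {P} → AllPairs _<_ P → All (Sum3 P) (tripleSums _+_ P)
tripleSums-sound [] = []
tripleSums-sound (x< ∷ inc) = All.++⁺
  (All.map⁺ (All.map (λ (y , z , y∈ , z∈ , y<z , s≡) →
      _ , y , z , here refl , there y∈ , there z∈ , All.lookup x< y∈ , y<z , cong (_ +_) s≡)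
    (pairSums-sound inc)))
  (All.map (sum3-map there) (tripleSums-sound inc))

-- A linear form with coefficients in ℕ in m positive unknowns.
Form : ℕ → Set
Form = Vec ℕ

private variable
  m : ℕ

_⊕_ : Form m → Form m → Form m
_⊕_ = Vec.zipWith _+_

eval : Vec ℕ m → Form m → ℕ
eval [] [] = 0
eval (r ∷ ρ) (c ∷ φ) = c * r + eval ρ φ

eval-⊕ : (ρ : Vec ℕ m) (φ ψ : Form m) → eval ρ (φ ⊕ ψ) ≡ eval ρ φ + eval ρ ψ
eval-⊕ [] [] [] = refl
eval-⊕ (r ∷ ρ) (c ∷ φ) (d ∷ ψ) = trans (cong ((c + d) * r +_) (eval-⊕ ρ φ ψ)) (arith c d r _ _)
  where
  arith : ∀ c d r e f → (c + d) * r + (e + f) ≡ c * r + e + (d * r + f)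
  arith = solve-∀

eval-0 : (ρ : Vec ℕ m) → eval ρ (Vec.replicate m 0) ≡ 0
eval-0 [] = refl
eval-0 (r ∷ ρ) = eval-0 ρ

_≤ᶠ_ _<ᶠ_ : Form m → Form m → Bool
[]      ≤ᶠ []      = true
(c ∷ φ) ≤ᶠ (d ∷ ψ) = (c ≤ᵇ d) ∧ (φ ≤ᶠ ψ)
[]      <ᶠ []      = false
(c ∷ φ) <ᶠ (d ∷ ψ) = ((c <ᵇ d) ∧ (φ ≤ᶠ ψ)) ∨ ((c ≤ᵇ d) ∧ (φ <ᶠ ψ))

Positive : Vec ℕ m → Set
Positive = VAll.All (0 <_)

≤ᶠ-sound : (ρ : Vec ℕ m) (φ ψ : Form m) → T (φ ≤ᶠ ψ) → eval ρ φ ≤ eval ρ ψ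
≤ᶠ-sound [] [] [] _ = z≤n
≤ᶠ-sound (r ∷ ρ) (c ∷ φ) (d ∷ ψ) t with c≤d , φ≤ψ ← Equivalence.to T-∧ t =
  +-mono-≤ (*-monoˡ-≤ r (≤ᵇ⇒≤ c d c≤d)) (≤ᶠ-sound ρ φ ψ φ≤ψ)

-- A single strictly larger coefficient is enough, because the unknown that it multiplies is
-- positive.
<ᶠ-sound : {ρ : Vec ℕ m} → Positive ρ → (φ ψ : Form m) → T (φ <ᶠ ψ) → eval ρ φ < eval ρ ψ
<ᶠ-sound [] [] [] ()
<ᶠ-sound {ρ = r ∷ ρ} (r>0 ∷ pos) (c ∷ φ) (d ∷ ψ) t with Equivalence.to T-∨ t
... | inj₁ t₁ with c<d , φ≤ψ ← Equivalence.to T-∧ t₁ =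
  +-mono-<-≤ (*-monoˡ-< r {{ℕ.>-nonZero r>0}} (<ᵇ⇒< c d c<d)) (≤ᶠ-sound ρ φ ψ φ≤ψ)
... | inj₂ t₂ with c≤d , φ<ψ ← Equivalence.to T-∧ t₂ =
  +-mono-≤-< (*-monoˡ-≤ r (≤ᵇ⇒≤ c d c≤d)) (<ᶠ-sound pos φ ψ φ<ψ)

-- A form equal to or incomparable with the one it meets is dropped, so the length of a chain
-- is only a lower bound for the number of sums.
insert : Form m → List (Form m) → List (Form m)
insert φ [] = φ ∷ []
insert φ (ψ ∷ c) =
  if φ <ᶠ ψ then φ ∷ ψ ∷ c else (if ψ <ᶠ φ then ψ ∷ insert φ c else ψ ∷ c)

insert-All : {P : Form m → Set} {φ : Form m} (c : List (Form m)) → P φ → All P c → All P (insert φ c)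
insert-All [] p [] = p ∷ []
insert-All {φ = φ} (ψ ∷ c) p (q ∷ qs) with φ <ᶠ ψ
... | true = p ∷ q ∷ qs
... | false with ψ <ᶠ φ
... | true = q ∷ insert-All c p qs
... | false = q ∷ qs

insertAll : List (Form m) → List (Form m) → List (Form m)
insertAll c []       = c
insertAll c (φ ∷ φs) = insertAll (insert φ c) φs

insertAll-All : {P : Form m → Set} (c : List (Form m)) {φs : List (Form m)} → All P c → All P φs →
    All P (insertAll c φs)
insertAll-All c ps [] = ps
insertAll-All c {φ ∷ φs} ps (q ∷ qs) = insertAll-All (insert φ c) (insert-All c q ps) qs

-- The order is tested on the finished chain instead of being proved invariant under `insert`.
increasing : List (Form m) → Bool
increasing [] = true
increasing (φ ∷ []) = true
increasing (φ ∷ ψ ∷ c) = (φ <ᶠ ψ) ∧ increasing (ψ ∷ c)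

increasing-sound : {ρ : Vec ℕ m} → Positive ρ → (c : List (Form m)) → T (increasing c) →
    Unique (map (eval ρ) c)
increasing-sound {ρ = ρ} pos c t = AllPairs.map <⇒≢ (Linked⇒AllPairs <-trans (linked c t))
  where
  linked : ∀ c → T (increasing c) → Linked _<_ (map (eval ρ) c)
  linked [] _ = []
  linked (φ ∷ []) _ = [-]
  linked (φ ∷ ψ ∷ c) t =
    <ᶠ-sound pos φ ψ (proj₁ (Equivalence.to T-∧ t)) ∷ linked (ψ ∷ c)
        (proj₂ (Equivalence.to (T-∧ {φ <ᶠ ψ}) t))

points : Form m → List (Form m) → List (Form m)
points s []      = s ∷ []
points s (g ∷ w) = s ∷ points (s ⊕ g) w

eval-points : (ρ : Vec ℕ m) → ∀ s w → map (eval ρ) (points s w) ≡ pts (eval ρ s) (map (eval ρ) w)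
eval-points ρ s [] = refl
eval-points ρ s (g ∷ w) = cong (eval ρ s ∷_)
  (trans (eval-points ρ (s ⊕ g) w) (cong (λ p → pts p (map (eval ρ) w)) (eval-⊕ ρ s g)))

sumChain : List (Form m) → List (Form m)
sumChain w = insertAll [] (tripleSums _⊕_ (points (Vec.replicate _ 0) w))

valid : List (Form m) → Bool
valid w = all (Vec.replicate _ 0 <ᶠ_) w ∧ increasing (sumChain w)

-- For a valid word this is only a lower bound for the excess, since the chain may leave out sums.
excess : List (Form m) → ℕ
excess w = length (sumChain w) + 5 ∸ 3 * length w

module _ {ρ : Vec ℕ m} (pos : Positive ρ) (w : List (Form m)) (ok : T (valid w)) where

  sumChain-unique : Unique (map (eval ρ) (sumChain w))
  sumChain-unique = increasing-sound pos (sumChain w) (proj₂ (Equivalence.to T-∧ ok))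

  sumChain-sums : All (Sum3 (pts 0 (map (eval ρ) w))) (map (eval ρ) (sumChain w))
  sumChain-sums = All.map⁺ (insertAll-All [] [] (All.map⁻ (subst (All (Sum3 P)) (sym eq)
      (tripleSums-sound P-increasing))))
    where
    P : List ℕ
    P = pts 0 (map (eval ρ) w)
    points≡ : map (eval ρ) (points (Vec.replicate _ 0) w) ≡ P
    points≡ = trans (eval-points ρ _ w) (cong (λ s → pts s (map (eval ρ) w)) (eval-0 ρ))
    eq : map (eval ρ) (tripleSums _⊕_ (points (Vec.replicate _ 0) w)) ≡ tripleSums _+_ P
    eq = trans (map-tripleSums {_⊕_ = _⊕_} {_⊞_ = _+_} (eval ρ) (eval-⊕ ρ)
        (points (Vec.replicate _ 0) w)) (cong (tripleSums _+_) points≡)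
    positive-letter : ∀ φ → T (Vec.replicate _ 0 <ᶠ φ) → 0 < eval ρ φ
    positive-letter φ t = subst (_< eval ρ φ) (eval-0 ρ) (<ᶠ-sound pos _ φ t)
    P-increasing : AllPairs _<_ P
    P-increasing = pts-increasing
        (All.map⁺ (All.map (positive-letter _) (All.all⁺ _ w (proj₁ (Equivalence.to T-∧ ok)))))

-- A certificate uniform in the unknowns: whatever positive values they take, the excess is greater
-- than `n`. The test `cuts` below certifies in the same way an excess of at least `j`.
refutes : ℕ → List (Form m) → Bool
refutes n w = valid w ∧ (3 * length w + n <ᵇ length (sumChain w) + 5)

refutes-sound : ∀ {n} {ρ : Vec ℕ m} → Positive ρ → ∀ w → T (refutes n w) → Excess≤ n (map (eval ρ) w) → ⊥
refutes-sound {n = n} {ρ} pos w t e with ok , long ← Equivalence.to T-∧ t =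
  <⇒≱ (<ᵇ⇒< (3 * length w + n) (length (sumChain w) + 5) long) (begin
    length (sumChain w) + 5                ≡⟨ cong (_+ 5) (length-map (eval ρ) (sumChain w)) ⟨
    length (map (eval ρ) (sumChain w)) + 5 ≤⟨ bound e _ (sumChain-unique pos w ok)
        (sumChain-sums pos w ok) ⟩
    3 * length (map (eval ρ) w) + n        ≡⟨ cong (λ x → 3 * x + n) (length-map (eval ρ) w) ⟩
    3 * length w + n                       ∎)
  where open ≤-Reasoning

cuts : ℕ → List (Form m) → Bool
cuts j w = valid w ∧ (3 * length w + j ≤ᵇ length (sumChain w) + 5)

cuts-sound : ∀ {n} j {ρ : Vec ℕ m} → Positive ρ → ∀ f a b y → T (cuts j (f ++ a ∷ b ∷ [])) →
  Excess≤ n (map (eval ρ) f ++ eval ρ a ∷ eval ρ b ∷ y) → Excess≤ (n ∸ j) (eval ρ a ∷ eval ρ b ∷ y)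
cuts-sound j {ρ} pos f a b y t with ok , long ← Equivalence.to T-∧ t =
  excess-cut (map (eval ρ) f) _ _ y (map (eval ρ) (sumChain w)) (sumChain-unique pos w ok)
    (subst (λ v → All (Sum3 (pts 0 v)) (map (eval ρ) (sumChain w))) map≡ (sumChain-sums pos w ok))
    (begin
      3 * length (map (eval ρ) f ++ eval ρ a ∷ eval ρ b ∷ []) + j ≡⟨ cong (λ v → 3 * length v + j) map≡ ⟨
      3 * length (map (eval ρ) w) + j         ≡⟨ cong (λ x → 3 * x + j) (length-map (eval ρ) w) ⟩
      3 * length w + j                        ≤⟨ ≤ᵇ⇒≤ _ _ long ⟩
      length (sumChain w) + 5                 ≡⟨ cong (_+ 5) (length-map (eval ρ) (sumChain w)) ⟨
      length (map (eval ρ) (sumChain w)) + 5  ∎)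
  where
  open ≤-Reasoning
  w : List (Form _)
  w = f ++ a ∷ b ∷ []
  map≡ : map (eval ρ) w ≡ map (eval ρ) f ++ eval ρ a ∷ eval ρ b ∷ []
  map≡ = map-++ (eval ρ) f (a ∷ b ∷ [])

-- Passing to shorter words.

private
  e₃ : ∀ g a b → eval (g ∷ a ∷ b ∷ []) (1 ∷ 0 ∷ 0 ∷ []) ≡ g × eval (g ∷ a ∷ b ∷ [])
      (0 ∷ 1 ∷ 0 ∷ []) ≡ a × eval (g ∷ a ∷ b ∷ []) (0 ∷ 0 ∷ 1 ∷ []) ≡ b
  e₃ g a b = trans (+-identityʳ _) (+-identityʳ _) , trans (+-identityʳ _) (+-identityʳ _) ,
      trans (+-identityʳ _) (+-identityʳ _)

-- Four points always have four distinct 3-sums, that is, excess 0. Cutting off the block with gaps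
-- `g`, `a`, `b` therefore leaves the bound unchanged and removes only `g`. Two further gaps are
-- required because consecutive blocks share two.
excess-tail : ∀ {n} g z → 2 ≤ length z → Excess≤ n (g ∷ z) → Excess≤ n z
excess-tail g (_ ∷ []) (s≤s ()) _
excess-tail {n} g (a ∷ b ∷ y) _ e with positive e
... | g>0 ∷ a>0 ∷ b>0 ∷ _ with g≡ , a≡ , b≡ ← e₃ g a b =
  subst₂ (λ a b → Excess≤ n (a ∷ b ∷ y)) a≡ b≡
    (cuts-sound 0 (g>0 ∷ a>0 ∷ b>0 ∷ []) ((1 ∷ 0 ∷ 0 ∷ []) ∷ []) (0 ∷ 1 ∷ 0 ∷ []) (0 ∷ 0 ∷ 1 ∷ []) y _
      (subst (Excess≤ n) (sym (cong₂ _∷_ g≡ (cong₂ (λ a b → a ∷ b ∷ y) a≡ b≡))) e))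

excess-suffix : ∀ {n} x z → 2 ≤ length z → Excess≤ n (x ++ z) → Excess≤ n z
excess-suffix [] z _ e = e
excess-suffix (g ∷ x) z 2≤ e = excess-suffix x z 2≤
  (excess-tail g (x ++ z) (≤-trans 2≤ (≤-trans (m≤n+m (length z) (length x))
      (≤-reflexive (sym (length-++ x))))) e)

excess-prefix : ∀ {n} x z → 2 ≤ length x → Excess≤ n (x ++ z) → Excess≤ n x
excess-prefix {n} x z 2≤ e = subst (Excess≤ n) (reverse-involutive x)
  (excess-reverse (reverse x)
    (excess-suffix (reverse z) (reverse x) (≤-trans 2≤ (≤-reflexive (sym (length-reverse x))))
      (subst (Excess≤ n) (reverse-++ x z) (excess-reverse (x ++ z) e))))

-- Finding five elements in arithmetic progression.

complement : ∀ {m n} → m < n → ∃ λ t → 0 < t × n ≡ m + t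
complement {m} {n} m<n = n ∸ m , m<n⇒0<n∸m m<n , sym (m+[n∸m]≡n (<⇒≤ m<n))

module _ {k n : ℕ} {ρ : Vec ℕ k} (pos : Positive ρ) (P Q R S : Form k)
  (t₀ : T (refutes 0 (P ∷ Q ∷ R ∷ S ∷ []))) (t₁ : T (cuts 1 (P ∷ Q ∷ R ∷ S ∷ []))) where

  -- A block of five points with positive excess is cut off: this uses up two gaps and one unit of
  -- the allowed excess.
  gain : ∀ {p q r s y} → eval ρ P ≡ p → eval ρ Q ≡ q → eval ρ R ≡ r → eval ρ S ≡ s →
    Excess≤ n (p ∷ q ∷ r ∷ s ∷ y) → 1 ≤ n × Excess≤ (n ∸ 1) (r ∷ s ∷ y)
  gain {y = y} refl refl refl refl e = n≥1 n e , cuts-sound 1 pos (P ∷ Q ∷ []) R S y t₁ e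
    where
    n≥1 : ∀ n → Excess≤ n (map (eval ρ) (P ∷ Q ∷ R ∷ S ∷ []) ++ y) → 1 ≤ n
    n≥1 zero e = ⊥-elim (refutes-sound {n = 0} pos (P ∷ Q ∷ R ∷ S ∷ []) t₀
        (excess-prefix (map (eval ρ) (P ∷ Q ∷ R ∷ S ∷ [])) y (s≤s (s≤s z≤n)) e))
    n≥1 (suc n) e = s≤s z≤n

private
  e₁ : ∀ p → p + 0 + 0 ≡ p
  e₁ = solve-∀
  e₂ : ∀ p t → p + 0 + (t + 0 + 0) ≡ p + t
  e₂ = solve-∀

-- The 3-sums of five points a₀ < ... < a₄ are their total minus their 2-sums, and seven 2-sums are
-- unavoidable. An eighth appears if `p ≢ r`, which separates a₀ + a₃ from a₁ + a₂, or if `q ≢ s`,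
-- which separates a₁ + a₄ from a₂ + a₃. If both pairs agree, `p ≢ q` separates a₀ + a₄ from a₁ +
-- a₃.
progression-or-gain : ∀ {n} p q r s y → Excess≤ n (p ∷ q ∷ r ∷ s ∷ y) →
  (p ≡ q × p ≡ r × p ≡ s) ⊎ (1 ≤ n × Excess≤ (n ∸ 1) (r ∷ s ∷ y))
progression-or-gain p q r s y e with positive e
... | p>0 ∷ q>0 ∷ r>0 ∷ s>0 ∷ _ with <-cmp p r | <-cmp q s | <-cmp p q
-- Here and in the next cases the difference `t` becomes an unknown of its own, which makes the
-- separated sums comparable coefficientwise.
... | tri< p<r _ _ | _ | _ with t , t>0 , refl ← complement p<r =
  inj₂ (gain (p>0 ∷ q>0 ∷ t>0 ∷ s>0 ∷ []) (1 ∷ 0 ∷ 0 ∷ 0 ∷ []) (0 ∷ 1 ∷ 0 ∷ 0 ∷ [])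
      (1 ∷ 0 ∷ 1 ∷ 0 ∷ []) (0 ∷ 0 ∷ 0 ∷ 1 ∷ []) _ _
    (e₁ p) (e₁ q) (e₂ p t) (e₁ s) e)
... | tri> _ _ r<p | _ | _ with t , t>0 , refl ← complement r<p =
  inj₂ (gain (r>0 ∷ q>0 ∷ t>0 ∷ s>0 ∷ []) (1 ∷ 0 ∷ 1 ∷ 0 ∷ []) (0 ∷ 1 ∷ 0 ∷ 0 ∷ [])
      (1 ∷ 0 ∷ 0 ∷ 0 ∷ []) (0 ∷ 0 ∷ 0 ∷ 1 ∷ []) _ _
    (e₂ r t) (e₁ q) (e₁ r) (e₁ s) e)
... | tri≈ _ refl _ | tri< q<s _ _ | _ with t , t>0 , refl ← complement q<s =
  inj₂ (gain (p>0 ∷ q>0 ∷ t>0 ∷ []) (1 ∷ 0 ∷ 0 ∷ []) (0 ∷ 1 ∷ 0 ∷ []) (1 ∷ 0 ∷ 0 ∷ []) (0 ∷ 1 ∷ 1 ∷ []) _ _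
    (e₁ p) (e₁ q) (e₁ p) (e₂ q t) e)
... | tri≈ _ refl _ | tri> _ _ s<q | _ with t , t>0 , refl ← complement s<q =
  inj₂ (gain (p>0 ∷ s>0 ∷ t>0 ∷ []) (1 ∷ 0 ∷ 0 ∷ []) (0 ∷ 1 ∷ 1 ∷ []) (1 ∷ 0 ∷ 0 ∷ []) (0 ∷ 1 ∷ 0 ∷ []) _ _
    (e₁ p) (e₂ s t) (e₁ p) (e₁ s) e)
... | tri≈ _ refl _ | tri≈ _ refl _ | tri< p<q _ _ with t , t>0 , refl ← complement p<q =
  inj₂ (gain (p>0 ∷ t>0 ∷ []) (1 ∷ 0 ∷ []) (1 ∷ 1 ∷ []) (1 ∷ 0 ∷ []) (1 ∷ 1 ∷ []) _ _
    (e₁ p) (e₂ p t) (e₁ p) (e₂ p t) e)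
... | tri≈ _ refl _ | tri≈ _ refl _ | tri> _ _ q<p with t , t>0 , refl ← complement q<p =
  inj₂ (gain (q>0 ∷ t>0 ∷ []) (1 ∷ 1 ∷ []) (1 ∷ 0 ∷ []) (1 ∷ 1 ∷ []) (1 ∷ 0 ∷ []) _ _
    (e₂ q t) (e₁ q) (e₂ q t) (e₁ q) e)
... | tri≈ _ refl _ | tri≈ _ refl _ | tri≈ _ refl _ = inj₁ (refl , refl , refl)

-- Each failure removes two gaps and lowers `n` by one. When `n` reaches 0, four gaps are still
-- left, and they must be equal; hence the length `4 + 2 * n`.
progression : ∀ n w → Excess≤ n w → 4 + 2 * n ≤ length w →
  ∃ λ x → ∃ λ d → ∃ λ y → w ≡ x ++ d ∷ d ∷ d ∷ d ∷ y
progression n (p ∷ []) e (s≤s ())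
progression n (p ∷ q ∷ []) e (s≤s (s≤s ()))
progression n (p ∷ q ∷ r ∷ []) e (s≤s (s≤s (s≤s ())))
progression n (p ∷ q ∷ r ∷ s ∷ y) e len with progression-or-gain p q r s y e
... | inj₁ (refl , refl , refl) = [] , p , y , refl
... | inj₂ (s≤s {n = n′} _ , e′) with progression n′ (r ∷ s ∷ y) e′
    (≤-pred (≤-pred (subst (_≤ 4 + length y) (arith n′) len)))
  where
  arith : ∀ n → 4 + 2 * suc n ≡ 2 + (4 + 2 * n)
  arith = solve-∀
... | x , d , y′ , eq = p ∷ q ∷ x , d , y′ , cong (λ z → p ∷ q ∷ z) eq

-- Which gaps can follow a given pattern.

infixr 6 _·_
_·_ : ℕ → List ℕ → List ℕ
d · w = map (_* d) w

open DecMembership _≟_ using (_∈?_)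

-- With unit d and next gap g, the cases are g = c d, c d < g < (c + 1) d (unknowns g − c d and
-- (c + 1) d − g), and g > C d (unknowns d and g − C d).
nextAt : (n : ℕ) (p cs : List ℕ) (c : ℕ) → Bool
nextAt n p cs c = does (c ∈? cs) ∨ (c ≡ᵇ 0) ∨ refutes n (map (λ x → x ∷ []) p ++ (c ∷ []) ∷ [])

nextBetween : (n : ℕ) (p : List ℕ) (c : ℕ) → Bool
nextBetween n p c = refutes n (map (λ x → x ∷ x ∷ []) p ++ (suc c ∷ c ∷ []) ∷ [])

nextBeyond : (C n : ℕ) (p : List ℕ) → Bool
nextBeyond C n p = refutes n (map (λ x → x ∷ 0 ∷ []) p ++ (C ∷ 1 ∷ []) ∷ [])

next : (C n : ℕ) (p cs : List ℕ) → Bool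
next C n p cs = all (λ c → nextAt n p cs c ∧ nextBetween n p c) (upTo (suc C)) ∧ nextBeyond C n p

module _ {n : ℕ} {p : List ℕ} {d g : ℕ} {y : List ℕ} (1≤p : 1 ≤ length p)
    (e : Excess≤ n (d · p ++ g ∷ y)) where

  no-next : ∀ {k} {ρ : Vec ℕ k} → Positive ρ → (f : ℕ → Form k) (φ : Form k) →
    (∀ x → eval ρ (f x) ≡ x * d) → eval ρ φ ≡ g → T (refutes n (map f p ++ φ ∷ [])) → ⊥
  no-next {ρ = ρ} pos f φ f≡ φ≡ t = refutes-sound pos (map f p ++ φ ∷ []) t
    (subst (Excess≤ n) (sym word≡)
      (excess-prefix (d · p ++ g ∷ []) y 2≤ (subst (Excess≤ n) (sym (++-assoc (d · p) (g ∷ []) y)) e)))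
    where
    word≡ : map (eval ρ) (map f p ++ φ ∷ []) ≡ d · p ++ g ∷ []
    word≡ = trans (map-++ (eval ρ) (map f p) (φ ∷ []))
      (cong₂ _++_ (trans (sym (map-∘ p)) (map-cong f≡ p)) (cong (_∷ []) φ≡))
    2≤ : 2 ≤ length (d · p ++ g ∷ [])
    2≤ = ≤-trans (+-monoˡ-≤ 1 (≤-trans 1≤p (≤-reflexive (sym (length-map (_* d) p)))))
        (≤-reflexive (sym (length-++ (d · p))))

divide : ∀ {d} g → 0 < d → ∃₂ λ c r → r < d × g ≡ r + c * d
divide {d} g d>0 = g / d , g % d , m%n<n g d , m≡m%n+[m/n]*n g d
  where instance _ = >-nonZero d>0

next-sound : ∀ C n p cs → 1 ≤ length p → T (next C n p cs) → ∀ {d} → 0 < d → ∀ g y →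
  Excess≤ n (d · p ++ g ∷ y) → ∃ λ c → c ∈ cs × g ≡ c * d
next-sound C n p cs 1≤p t {d} d>0 g y e with divide g d>0
... | c , r , r<d , refl = locate (suc C ℕ.≤? c) (r ≟ 0)
  where
  within : (c : ℕ) → Bool
  within c = nextAt n p cs c ∧ nextBetween n p c
  t-split : T (all within (upTo (suc C))) × T (nextBeyond C n p)
  t-split = Equivalence.to (T-∧ {all within (upTo (suc C))}) t
  t-at : c < suc C → T (nextAt n p cs c) × T (nextBetween n p c)
  t-at c≤C = Equivalence.to (T-∧ {nextAt n p cs c}) (All.lookup (All.all⁺ within (upTo (suc C))
      (proj₁ t-split)) (∈-upTo⁺ c≤C))
  at : T (nextAt n p cs c) → r ≡ 0 → c ∈ cs
  at t r≡0 with c ∈? cs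
  ... | yes c∈ = c∈
  ... | no _ with Equivalence.to (T-∨ {c ≡ᵇ 0}) t
  -- Quotient and remainder 0 would mean a gap of length 0.
  ... | inj₁ c≡0 = contradiction (subst (0 <_) (cong₂ (λ r c → r + c * d) r≡0 (≡ᵇ⇒≡ c 0 c≡0))
      (All.head (All.++⁻ʳ (d · p) (positive e)))) (<-irrefl refl)
  ... | inj₂ t′ = ⊥-elim (no-next 1≤p e (d>0 ∷ []) (λ x → x ∷ []) (c ∷ []) (λ x → +-identityʳ (x * d))
    (trans (+-identityʳ _) (cong (_+ c * d) (sym r≡0))) t′)
  locate : Dec (suc C ≤ c) → Dec (r ≡ 0) → ∃ λ c′ → c′ ∈ cs × r + c * d ≡ c′ * d
  locate (yes C<c) _ with s , s>0 , g≡ ← complement {C * d} {r + c * d}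
      (≤-trans (*-monoˡ-< d {{>-nonZero d>0}} C<c) (m≤n+m (c * d) r)) =
    ⊥-elim (no-next 1≤p e (d>0 ∷ s>0 ∷ []) (λ x → x ∷ 0 ∷ []) (C ∷ 1 ∷ []) (λ x → +-identityʳ (x * d))
      (trans (cong (C * d +_) (trans (+-identityʳ _) (+-identityʳ s))) (sym g≡)) (proj₂ t-split))
  locate (no C≮c) (yes r≡0) = c , at (proj₁ (t-at (≰⇒> C≮c))) r≡0 , cong (_+ c * d) r≡0
  -- In the unknowns `r` and `s` the unit is `d = r + s`, so a gap `x * d` has both coefficients
  -- `x`, and `g` has coefficients `c + 1` and `c`.
  locate (no C≮c) (no r≢0) with s , s>0 , d≡ ← complement r<d =
    ⊥-elim (no-next 1≤p e (n≢0⇒n>0 r≢0 ∷ s>0 ∷ []) (λ x → x ∷ x ∷ []) (suc c ∷ c ∷ [])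
      (λ x → trans (arith₁ x r s) (cong (x *_) (sym d≡)))
      (trans (arith₂ c r s) (cong (λ z → r + c * z) (sym d≡))) (proj₂ (t-at (≰⇒> C≮c))))
    where
    arith₁ : ∀ x r s → x * r + (x * s + 0) ≡ x * (r + s)
    arith₁ = solve-∀
    arith₂ : ∀ c r s → suc c * r + (c * s + 0) ≡ r + c * (r + s)
    arith₂ = solve-∀

-- The irregular ends beside a run of unit gaps.

ones : ℕ → List ℕ
ones n = replicate n 1

-- The branches of the search carried out in `tail`, which continues a run as long as the excess can
-- stay at most 3.
short : List (List ℕ)
short = [] ∷ (2 ∷ []) ∷ (3 ∷ []) ∷ (4 ∷ []) ∷ (2 ∷ 1 ∷ []) ∷ (2 ∷ 2 ∷ []) ∷ (2 ∷ 1 ∷ 1 ∷ []) ∷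
  (2 ∷ 1 ∷ 2 ∷ []) ∷ (2 ∷ 1 ∷ 1 ∷ 1 ∷ []) ∷ []

open DecMembership (≡-dec _≟_) using () renaming (_∈?_ to _∈ʷ?_)

isShort : ∀ t → {True (t ∈ʷ? short)} → t ∈ short
isShort t {t∈} = toWitness t∈

-- The gaps that may follow a run of at least four unit gaps.
Tail : List ℕ → Set
Tail w = ∃ λ n → ∃ λ t → ∃ λ m → t ∈ short × (m ≡ 0 ⊎ t ≡ 2 ∷ 1 ∷ 1 ∷ 1 ∷ []) × w ≡ ones n ++ t ++ ones m

tail-short : ∀ t → {True (t ∈ʷ? short)} → Tail t
tail-short t {t∈} = 0 , t , 0 , toWitness t∈ , inj₁ refl , sym (++-identityʳ t)

Next : ℕ → List ℕ → List ℕ → Set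
Next n p cs = ∀ {d} → 0 < d → ∀ g y → Excess≤ n (d · p ++ g ∷ y) → ∃ λ c → c ∈ cs × g ≡ c * d

abstract
  -- The bound 12 in these computations is no mathematical threshold: it only has to be so large
  -- that `nextBeyond` succeeds for each pattern.
  next-0-1111 : Next 0 (ones 4) (1 ∷ [])
  next-0-1111 = next-sound 12 0 (ones 4) (1 ∷ []) (s≤s z≤n) _

  next-11112111 : Next 3 (1 ∷ 1 ∷ 1 ∷ 1 ∷ 2 ∷ 1 ∷ 1 ∷ 1 ∷ []) (1 ∷ [])
  next-11112111 = next-sound 12 3 (1 ∷ 1 ∷ 1 ∷ 1 ∷ 2 ∷ 1 ∷ 1 ∷ 1 ∷ []) (1 ∷ []) (s≤s z≤n) _

  next-111121111 : Next 3 (1 ∷ 1 ∷ 1 ∷ 1 ∷ 2 ∷ 1 ∷ 1 ∷ 1 ∷ 1 ∷ []) (1 ∷ [])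
  next-111121111 = next-sound 12 3 (1 ∷ 1 ∷ 1 ∷ 1 ∷ 2 ∷ 1 ∷ 1 ∷ 1 ∷ 1 ∷ []) (1 ∷ []) (s≤s z≤n) _

  next-1111 : Next 3 (ones 4) (1 ∷ 2 ∷ 3 ∷ 4 ∷ [])
  next-1111 = next-sound 12 3 (ones 4) (1 ∷ 2 ∷ 3 ∷ 4 ∷ []) (s≤s z≤n) _

  next-11112 : Next 3 (1 ∷ 1 ∷ 1 ∷ 1 ∷ 2 ∷ []) (1 ∷ 2 ∷ [])
  next-11112 = next-sound 12 3 (1 ∷ 1 ∷ 1 ∷ 1 ∷ 2 ∷ []) (1 ∷ 2 ∷ []) (s≤s z≤n) _

  next-111121 : Next 3 (1 ∷ 1 ∷ 1 ∷ 1 ∷ 2 ∷ 1 ∷ []) (1 ∷ 2 ∷ [])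
  next-111121 = next-sound 12 3 (1 ∷ 1 ∷ 1 ∷ 1 ∷ 2 ∷ 1 ∷ []) (1 ∷ 2 ∷ []) (s≤s z≤n) _

  next-1111211 : Next 3 (1 ∷ 1 ∷ 1 ∷ 1 ∷ 2 ∷ 1 ∷ 1 ∷ []) (1 ∷ [])
  next-1111211 = next-sound 12 3 (1 ∷ 1 ∷ 1 ∷ 1 ∷ 2 ∷ 1 ∷ 1 ∷ []) (1 ∷ []) (s≤s z≤n) _

  stop-11113 : Next 3 (1 ∷ 1 ∷ 1 ∷ 1 ∷ 3 ∷ []) []
  stop-11113 = next-sound 12 3 (1 ∷ 1 ∷ 1 ∷ 1 ∷ 3 ∷ []) [] (s≤s z≤n) _

  stop-11114 : Next 3 (1 ∷ 1 ∷ 1 ∷ 1 ∷ 4 ∷ []) []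
  stop-11114 = next-sound 12 3 (1 ∷ 1 ∷ 1 ∷ 1 ∷ 4 ∷ []) [] (s≤s z≤n) _

  stop-111122 : Next 3 (1 ∷ 1 ∷ 1 ∷ 1 ∷ 2 ∷ 2 ∷ []) []
  stop-111122 = next-sound 12 3 (1 ∷ 1 ∷ 1 ∷ 1 ∷ 2 ∷ 2 ∷ []) [] (s≤s z≤n) _

  stop-1111212 : Next 3 (1 ∷ 1 ∷ 1 ∷ 1 ∷ 2 ∷ 1 ∷ 2 ∷ []) []
  stop-1111212 = next-sound 12 3 (1 ∷ 1 ∷ 1 ∷ 1 ∷ 2 ∷ 1 ∷ 2 ∷ []) [] (s≤s z≤n) _

  -- For `d = 1` the block `1 1 1 1 2 1 1 1` is `[0,9]` without 5. All numbers from 3 to 24 are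
  -- 3-sums of it, 22 instead of the minimal 19, so it uses up the whole excess of 3.
  cut-2111 : ∀ {d} → 0 < d → ∀ y →
    Excess≤ 3 (d · (1 ∷ 1 ∷ 1 ∷ 1 ∷ 2 ∷ 1 ∷ 1 ∷ 1 ∷ 1 ∷ 1 ∷ []) ++ y) → Excess≤ 0 (d · ones 4 ++ y)
  cut-2111 {d} d>0 y e = subst (λ a → Excess≤ 0 (a ∷ a ∷ 1 * d ∷ 1 * d ∷ y)) (+-identityʳ _)
    (cuts-sound 3 (d>0 ∷ []) (map (_∷ []) (1 ∷ 1 ∷ 1 ∷ 1 ∷ 2 ∷ 1 ∷ [])) (1 ∷ []) (1 ∷ [])
        (1 * d ∷ 1 * d ∷ y) _
      (subst₂ (λ a b → Excess≤ 3 (a ∷ a ∷ a ∷ a ∷ b ∷ a ∷ a ∷ a ∷ 1 * d ∷ 1 * d ∷ y))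
        (sym (+-identityʳ _)) (sym (+-identityʳ _)) e))

module _ {d : ℕ} (d>0 : 0 < d) where

  run-only : ∀ y → Excess≤ 0 (d · ones 4 ++ y) → ∃ λ m → y ≡ d · ones m
  run-only [] _ = 0 , refl
  run-only (g ∷ y) e with next-0-1111 d>0 g y e
  ... | _ , here refl , refl with run-only y (excess-tail _ _ (s≤s (s≤s z≤n)) e)
  ... | m , refl = suc m , refl

  after-2111 : ∀ y → Excess≤ 3 (d · (1 ∷ 1 ∷ 1 ∷ 1 ∷ 2 ∷ 1 ∷ 1 ∷ 1 ∷ []) ++ y) → ∃ λ m → y ≡ d · ones m
  after-2111 [] _ = 0 , refl
  after-2111 (g ∷ y) e with next-11112111 d>0 g y e
  after-2111 (g ∷ []) e | _ , here refl , refl = 1 , refl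
  after-2111 (g ∷ h ∷ y) e | _ , here refl , refl
    with next-111121111 d>0 h y e
  -- The cut keeps only the last two gaps of the block. With the two unit gaps just forced they form
  -- the run of four from which `run-only` starts.
  ... | _ , here refl , refl with run-only y (cut-2111 d>0 y e)
  ... | m , refl = suc (suc m) , refl

  tail : ∀ y → Excess≤ 3 (d · ones 4 ++ y) → ∃ λ t → Tail t × y ≡ d · t
  after-2 : ∀ y → Excess≤ 3 (d · (1 ∷ 1 ∷ 1 ∷ 1 ∷ 2 ∷ []) ++ y) → ∃ λ t → Tail t × 2 * d ∷ y ≡ d · t
  after-21 : ∀ y → Excess≤ 3 (d · (1 ∷ 1 ∷ 1 ∷ 1 ∷ 2 ∷ 1 ∷ []) ++ y) → ∃ λ t →
      Tail t × 2 * d ∷ 1 * d ∷ y ≡ d · t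
  stop : ∀ p → (∀ g y → Excess≤ 3 (d · p ++ g ∷ y) → ∃ λ c → c ∈ [] × g ≡ c * d) →
    ∀ y → Excess≤ 3 (d · p ++ y) → y ≡ []

  stop p none [] e = refl
  stop p none (g ∷ y) e with none g y e
  ... | _ , () , _

  tail [] e = [] , tail-short [] , refl
  tail (g ∷ y) e with next-1111 d>0 g y e
  -- Dropping the first gap of the run moves the window of four unit gaps one place on.
  ... | _ , here refl , refl with tail y (excess-tail _ _ (s≤s (s≤s z≤n)) e)
  ...   | t , (n , s , m , s∈ , long , refl) , refl = 1 ∷ t , (suc n , s , m , s∈ , long , refl) , refl
  tail (g ∷ y) e | _ , there (here refl) , refl = after-2 y e
  tail (g ∷ y) e | _ , there (there (here refl)) , refl
    with refl ← stop (1 ∷ 1 ∷ 1 ∷ 1 ∷ 3 ∷ []) (stop-11113 d>0) y e = 3 ∷ [] , tail-short _ , refl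
  tail (g ∷ y) e | _ , there (there (there (here refl))) , refl
    with refl ← stop (1 ∷ 1 ∷ 1 ∷ 1 ∷ 4 ∷ []) (stop-11114 d>0) y e = 4 ∷ [] , tail-short _ , refl

  after-2 [] e = 2 ∷ [] , tail-short _ , refl
  after-2 (g ∷ y) e with next-11112 d>0 g y e
  ... | _ , here refl , refl = after-21 y e
  ... | _ , there (here refl) , refl
    with refl ← stop (1 ∷ 1 ∷ 1 ∷ 1 ∷ 2 ∷ 2 ∷ []) (stop-111122 d>0) y e = 2 ∷ 2 ∷ [] , tail-short _ , refl

  after-21 [] e = 2 ∷ 1 ∷ [] , tail-short _ , refl
  after-21 (g ∷ y) e with next-111121 d>0 g y e
  ... | _ , there (here refl) , refl
    with refl ← stop (1 ∷ 1 ∷ 1 ∷ 1 ∷ 2 ∷ 1 ∷ 2 ∷ []) (stop-1111212 d>0) y e = 2 ∷ 1 ∷ 2 ∷ [] ,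
        tail-short _ , refl
  after-21 (g ∷ []) e | _ , here refl , refl = 2 ∷ 1 ∷ 1 ∷ [] , tail-short _ , refl
  after-21 (g ∷ h ∷ y) e | _ , here refl , refl
    with next-1111211 d>0 h y e
  ... | _ , here refl , refl with after-2111 y e
  ... | m , refl = 2 ∷ 1 ∷ 1 ∷ 1 ∷ ones m ,
    (0 , 2 ∷ 1 ∷ 1 ∷ 1 ∷ [] , m , isShort _ , inj₂ refl , refl) , refl

-- The common difference is 1, and the left end can be taken short.

·-reverse : ∀ d w → reverse (d · w) ≡ d · reverse w
·-reverse d w = sym (reverse-map (_* d) w)

1· : ∀ w → 1 · w ≡ w
1· w = trans (map-cong *-identityʳ w) (map-id w)

·-++ : ∀ d u v → d · (u ++ v) ≡ d · u ++ d · v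
·-++ d = map-++ (_* d)

reverse-++₃ : ∀ (x y z : List ℕ) → reverse (x ++ y ++ z) ≡ reverse z ++ reverse y ++ reverse x
reverse-++₃ x y z = trans (reverse-++ x (y ++ z))
  (trans (cong (_++ reverse x) (reverse-++ y z)) (++-assoc (reverse z) (reverse y) (reverse x)))

Primitive : List ℕ → Set
Primitive w = ∀ d z → w ≡ d · z → d ≡ 1

primitive-reverse : ∀ w → Primitive w → Primitive (reverse w)
primitive-reverse w prim d z eq = prim d (reverse z)
  (trans (sym (reverse-involutive w)) (trans (cong reverse eq) (·-reverse d z)))

-- The progression is continued to the right and, after reflection, to the left. Both continuations
-- consist of multiples of `d`, so `d` divides every gap and primitivity gives `d = 1`.
run : ∀ w → Excess≤ 3 w → 10 ≤ length w → Primitive w → ∃ λ x → ∃ λ t → Tail t × w ≡ x ++ ones 4 ++ t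
run w e len prim with progression 3 w e len
... | x , d , y , refl with tail d>0 y right | tail d>0 (reverse x) left
  where
  rung : d ∷ d ∷ d ∷ d ∷ [] ≡ d · ones 4
  rung = cong (λ a → a ∷ a ∷ a ∷ a ∷ []) (sym (+-identityʳ d))
  d>0 : 0 < d
  d>0 = All.head (All.++⁻ʳ x (positive e))
  right : Excess≤ 3 (d · ones 4 ++ y)
  right = subst (λ r → Excess≤ 3 (r ++ y)) rung (excess-suffix x (d ∷ d ∷ d ∷ d ∷ y) (s≤s (s≤s z≤n)) e)
  left : Excess≤ 3 (d · ones 4 ++ reverse x)
  left = subst (λ r → Excess≤ 3 (r ++ reverse x)) rung
    (excess-suffix (reverse y) (d ∷ d ∷ d ∷ d ∷ reverse x) (s≤s (s≤s z≤n))
      (subst (Excess≤ 3) (reverse-++₃ x (d ∷ d ∷ d ∷ d ∷ []) y)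
          (excess-reverse (x ++ d ∷ d ∷ d ∷ d ∷ y) e)))
... | t , Tt , refl | t′ , _ , x≡ with w≡
  where
  w≡ : x ++ d ∷ d ∷ d ∷ d ∷ d · t ≡ d · (reverse t′ ++ ones 4 ++ t)
  w≡ = trans (cong₂ (λ x a → x ++ a ∷ a ∷ a ∷ a ∷ d · t)
      (trans (sym (reverse-involutive x)) (trans (cong reverse x≡) (·-reverse d t′))) (sym (+-identityʳ d)))
    (sym (·-++ d (reverse t′) (ones 4 ++ t)))
... | eq with refl ← prim d (reverse t′ ++ ones 4 ++ t) eq = reverse t′ , t , Tt , trans eq (1· _)

ones-++ : ∀ a b → ones a ++ ones b ≡ ones (a + b)
ones-++ zero b = refl
ones-++ (suc a) b = cong (1 ∷_) (ones-++ a b)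

ones-swap : ∀ a b z → ones a ++ ones b ++ z ≡ ones b ++ ones a ++ z
ones-swap a b z = begin
  ones a ++ ones b ++ z   ≡⟨ ++-assoc (ones a) (ones b) z ⟨
  (ones a ++ ones b) ++ z ≡⟨ cong (_++ z) (trans (ones-++ a b) (trans (cong ones (+-comm a b))
      (sym (ones-++ b a)))) ⟩
  (ones b ++ ones a) ++ z ≡⟨ ++-assoc (ones b) (ones a) z ⟩
  ones b ++ ones a ++ z   ∎
  where open ≡-Reasoning

-- If further unit gaps follow the end `2 1 1 1`, then the word closes with at least four unit gaps.
-- These form a later run, and the end behind it is empty.
last-run : ∀ {t} → Tail t → ∃ λ x → ∃ λ v → v ∈ short × ones 4 ++ t ≡ x ++ ones 4 ++ v
last-run (n , s , zero , s∈ , _ , refl) = ones n , s , s∈ ,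
  trans (cong (λ s → ones 4 ++ ones n ++ s) (++-identityʳ s)) (ones-swap 4 n s)
last-run (n , s , suc m , s∈ , inj₂ refl , refl) = ones 4 ++ ones n ++ 2 ∷ ones m , [] , isShort [] ,
  cong (ones 4 ++_) (trans (cong (λ z → ones n ++ 2 ∷ z) swap)
      (sym (++-assoc (ones n) (2 ∷ ones m) (ones 4))))
  where
  swap : ones 4 ++ ones m ≡ ones m ++ ones 4
  swap = trans (cong (ones 4 ++_) (sym (++-identityʳ (ones m)))) (ones-swap 4 m [])

reversed-run : ∀ w {x x′ v t} → reverse w ≡ x ++ ones 4 ++ t → ones 4 ++ t ≡ x′ ++ ones 4 ++ v →
  w ≡ reverse v ++ ones 4 ++ reverse (x ++ x′)
reversed-run w {x} {x′} {v} {t} eq eq′ = begin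
  w                                             ≡⟨ reverse-involutive w ⟨
  reverse (reverse w)                           ≡⟨ cong reverse (trans eq (cong (x ++_) eq′)) ⟩
  reverse (x ++ x′ ++ ones 4 ++ v)              ≡⟨ cong reverse (++-assoc x x′ _) ⟨
  reverse ((x ++ x′) ++ ones 4 ++ v)            ≡⟨ reverse-++₃ (x ++ x′) (ones 4) v ⟩
  reverse v ++ ones 4 ++ reverse (x ++ x′)      ∎
  where open ≡-Reasoning

-- Taking the last run of the reversed word makes the left end short.
run-between : ∀ w → Excess≤ 3 w → 10 ≤ length w → Primitive w →
  ∃ λ v → ∃ λ t → v ∈ short × Tail t × w ≡ reverse v ++ ones 4 ++ t
run-between w e len prim
  with run (reverse w) (excess-reverse w e) (≤-trans len (≤-reflexive (sym (length-reverse w))))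
    (primitive-reverse w prim)
... | x , t , Tt , eq with last-run Tt
... | x′ , v , v∈ , eq′ with w≡ ← reversed-run w eq eq′ with tail (s≤s z≤n) (reverse (x ++ x′))
      (excess-suffix (reverse v) _ (s≤s (s≤s z≤n)) (subst (Excess≤ 3) w≡ e))
... | t₂ , T₂ , eq₂ = v , t₂ , v∈ , T₂ , trans w≡ (cong (λ z → reverse v ++ ones 4 ++ z)
    (trans eq₂ (1· t₂)))

-- The pairs of ends with total excess at most 3.

-- Beside a long run the end `2` contributes excess 1; `3`, `2 1` and `2 1 1` contribute 2; `4`,
-- `2 2`, `2 1 2` and `2 1 1 1` contribute 3. Left ends are the mirror images, and the pairs listed
-- are those of total at most 3.
admissible : List (List ℕ × List ℕ)
admissible =
  map ([] ,_) short ++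
  map ((2 ∷ []) ,_) ([] ∷ (2 ∷ []) ∷ (3 ∷ []) ∷ (2 ∷ 1 ∷ []) ∷ (2 ∷ 1 ∷ 1 ∷ []) ∷ []) ++
  map ((3 ∷ []) ,_) ([] ∷ (2 ∷ []) ∷ []) ++
  map ((4 ∷ []) ,_) ([] ∷ []) ++
  map ((1 ∷ 2 ∷ []) ,_) ([] ∷ (2 ∷ []) ∷ []) ++
  map ((2 ∷ 2 ∷ []) ,_) ([] ∷ []) ++
  map ((1 ∷ 1 ∷ 2 ∷ []) ,_) ([] ∷ (2 ∷ []) ∷ []) ++
  map ((2 ∷ 1 ∷ 2 ∷ []) ,_) ([] ∷ []) ++
  map ((1 ∷ 1 ∷ 1 ∷ 2 ∷ []) ,_) ([] ∷ [])

open DecMembership (Product.≡-dec (≡-dec _≟_) (≡-dec _≟_)) using () renaming (_∈?_ to _∈ᵖ?_)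

unit : List ℕ → List (Form 1)
unit = map (_∷ [])

eval-unit : ∀ w → map (eval (1 ∷ [])) (unit w) ≡ w
eval-unit w = trans (sym (map-∘ w))
    (trans (map-cong (λ x → trans (+-identityʳ _) (*-identityʳ x)) w) (map-id w))

unit-refutes : ∀ {n} w → T (refutes n (unit w)) → ¬ Excess≤ n w
unit-refutes {n} w t e = refutes-sound (s≤s z≤n ∷ []) (unit w) t (subst (Excess≤ n) (sym (eval-unit w)) e)

-- Runs of length 4 and 5 are refuted directly; a longer one can be cut in its interior.
clash : List ℕ → List ℕ → Bool
clash u t = refutes 3 (unit (u ++ ones 4 ++ t)) ∧ refutes 3 (unit (u ++ ones 5 ++ t))
  ∧ cuts j (unit (u ++ ones 2) ++ (1 ∷ []) ∷ (1 ∷ []) ∷ []) ∧ refutes (3 ∸ j) (unit (ones 4 ++ t))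
  where
  j : ℕ
  j = excess (unit (u ++ ones 4))

decided-or : {P : Set} → Dec P → Bool → Bool
decided-or (yes _) _ = true
decided-or (no _)  b = b

decided-or-sound : {P : Set} (p? : Dec P) (b : Bool) → T (decided-or p? b) → ¬ T b → P
decided-or-sound (yes p) b t ¬b = p
decided-or-sound (no _)  b t ¬b = contradiction t ¬b

admissible-or-clash : List ℕ → List ℕ → Bool
admissible-or-clash v t = decided-or ((reverse v , t) ∈ᵖ? admissible) (clash (reverse v) t)

all₂ : {A B : Set} (q : A → B → Bool) (xs : List A) (ys : List B) → Bool
all₂ q xs ys = all (λ x → all (q x) ys) xs

all₂-sound : {A B : Set} (q : A → B → Bool) (xs : List A) (ys : List B) → all₂ q xs ys ≡ true →
  ∀ {x y} → x ∈ xs → y ∈ ys → T (q x y)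
all₂-sound q xs ys eq {x} x∈ y∈ = All.lookup (All.all⁺ (q x) ys
  (All.lookup (All.all⁺ (λ x → all (q x) ys) xs (Equivalence.from T-≡ eq)) x∈)) y∈

abstract
  -- Of the 81 pairs of short ends, evaluation refutes the 57 that are not in the list.
  table : all₂ admissible-or-clash short short ≡ true
  table = refl

shorten-run : ∀ {n} k t → Excess≤ n (ones (4 + k) ++ t) → Excess≤ n (ones 4 ++ t)
shorten-run zero t e = e
shorten-run (suc k) t e = shorten-run k t (excess-tail 1 (ones (4 + k) ++ t) (s≤s (s≤s z≤n)) e)

clash-split : ∀ u t → T (clash u t) →
  T (refutes 3 (unit (u ++ ones 4 ++ t))) × T (refutes 3 (unit (u ++ ones 5 ++ t))) ×
  T (cuts (excess (unit (u ++ ones 4))) (unit (u ++ ones 2) ++ (1 ∷ []) ∷ (1 ∷ []) ∷ [])) ×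
  T (refutes (3 ∸ excess (unit (u ++ ones 4))) (unit (ones 4 ++ t)))
clash-split u t c = proj₁ c₁ , proj₁ c₂ , c₃
  where
  c₁ = Equivalence.to (T-∧ {refutes 3 (unit (u ++ ones 4 ++ t))}) c
  c₂ = Equivalence.to (T-∧ {refutes 3 (unit (u ++ ones 5 ++ t))}) (proj₂ c₁)
  c₃ = Equivalence.to (T-∧ {cuts (excess (unit (u ++ ones 4))) (unit (u ++ ones 2) ++
      (1 ∷ []) ∷ (1 ∷ []) ∷ [])}) (proj₂ c₂)

no-clash : ∀ u k t → T (clash u t) → ¬ Excess≤ 3 (u ++ ones (4 + k) ++ t)
no-clash u zero t c e = unit-refutes (u ++ ones 4 ++ t) (proj₁ (clash-split u t c)) e
no-clash u (suc zero) t c e = unit-refutes (u ++ ones 5 ++ t) (proj₁ (proj₂ (clash-split u t c))) e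
-- With at least six unit gaps, the left block takes the first four and shares the last two of
-- these, so at least four remain on the right.
no-clash u (suc (suc k)) t c e =
  unit-refutes (ones 4 ++ t) (proj₂ (proj₂ (proj₂ (clash-split u t c)))) (shorten-run k t
    (cuts-sound (excess (unit (u ++ ones 4))) (s≤s z≤n ∷ []) (unit (u ++ ones 2)) (1 ∷ []) (1 ∷ [])
        (ones (2 + k) ++ t)
      (proj₁ (proj₂ (proj₂ (clash-split u t c))))
      (subst (Excess≤ 3) (trans (sym (++-assoc u (ones 2) _)) (cong (_++ ones (4 + k) ++ t)
          (sym (eval-unit (u ++ ones 2))))) e)))

admissible-or-clash-short : ∀ {v t} → v ∈ short → t ∈ short → T (admissible-or-clash v t)
admissible-or-clash-short v∈ t∈ = all₂-sound admissible-or-clash short short table v∈ t∈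

admissible-unless-clash : ∀ v t → T (admissible-or-clash v t) → ¬ T (clash (reverse v) t) →
    (reverse v , t) ∈ admissible
admissible-unless-clash v t = decided-or-sound ((reverse v , t) ∈ᵖ? admissible) (clash (reverse v) t)

admissible-ends : ∀ {v t} k z → v ∈ short → t ∈ short → Excess≤ 3 (reverse v ++ ones (4 + k) ++ t ++ z) →
  (reverse v , t) ∈ admissible
admissible-ends {v} {t} k z v∈ t∈ e = admissible-unless-clash v t (admissible-or-clash-short v∈ t∈)
  (λ c → no-clash (reverse v) k t c
    (excess-prefix (reverse v ++ ones (4 + k) ++ t) z long (subst (Excess≤ 3) (sym assoc) e)))
  where
  assoc : (reverse v ++ ones (4 + k) ++ t) ++ z ≡ reverse v ++ ones (4 + k) ++ t ++ z
  assoc = trans (++-assoc (reverse v) (ones (4 + k) ++ t) z) (cong (reverse v ++_)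
      (++-assoc (ones (4 + k)) t z))
  long : 2 ≤ length (reverse v ++ ones (4 + k) ++ t)
  long = ≤-trans (s≤s (s≤s z≤n)) (≤-trans (m≤n+m (length (ones (4 + k) ++ t)) (length (reverse v)))
      (≤-reflexive (sym (length-++ (reverse v)))))

Ends : List ℕ → Set
Ends w = ∃ λ u → ∃ λ k → ∃ λ t → ∃ λ m → (u , t) ∈ admissible × (m ≡ 0 ⊎ t ≡ 2 ∷ 1 ∷ 1 ∷ 1 ∷ []) ×
  w ≡ u ++ ones (4 + k) ++ t ++ ones m

run-between⇒ends : ∀ {w v t} → Excess≤ 3 w → v ∈ short → Tail t → w ≡ reverse v ++ ones 4 ++ t → Ends w
run-between⇒ends {w} {v} e v∈ (k , t , m , t∈ , long , refl) w≡ =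
  reverse v , k , t , m , admissible-ends k (ones m) v∈ t∈ (subst (Excess≤ 3) w≡′ e) , long , w≡′
  where
  w≡′ : w ≡ reverse v ++ ones (4 + k) ++ t ++ ones m
  w≡′ = trans w≡ (cong (reverse v ++_) (trans (sym (++-assoc (ones 4) (ones k) _))
      (cong (_++ t ++ ones m) (ones-++ 4 k))))

classification : ∀ w → Excess≤ 3 w → 10 ≤ length w → Primitive w → Ends w
classification w e len prim =
  let v , t , v∈ , Tt , w≡ = run-between w e len prim in run-between⇒ends e v∈ Tt w≡

-- The integers that a word omits.

sum-ones : ∀ n → sum (ones n) ≡ n
sum-ones zero = refl
sum-ones (suc n) = cong suc (sum-ones n)

reverse-ones : ∀ n → reverse (ones n) ≡ ones n
reverse-ones zero = refl
reverse-ones (suc n) = trans (unfold-reverse 1 (ones n)) (trans (cong (_++ ones 1) (reverse-ones n))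
  (trans (ones-++ n 1) (cong ones (+-comm n 1))))

sum-around : ∀ u n v → sum (u ++ ones n ++ v) ≡ sum u + (sum v + n)
sum-around u n v = trans (sum-++ u (ones n ++ v)) (cong (sum u +_)
  (trans (sum-++ (ones n) v) (trans (cong (_+ sum v) (sum-ones n)) (+-comm n (sum v)))))

length-around : ∀ (u : List ℕ) n v → length (u ++ ones n ++ v) ≡ length u + (length v + n)
length-around u n v = trans (length-++ u) (cong (length u +_)
  (trans (length-++ (ones n)) (trans (cong (_+ length v) (length-replicate n)) (+-comm n (length v)))))

-- The holes of the set in increasing order: a gap `g` skips `g ∸ 1` integers.
gaps : ℕ → List ℕ → List ℕ
gaps s []      = []
gaps s (g ∷ w) = applyUpTo (λ i → suc (i + s)) (g ∸ 1) ++ gaps (g + s) w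

gaps-> : ∀ s w {t} → t ∈ gaps s w → s < t
gaps-> s (g ∷ w) t∈ with ∈-++⁻ (applyUpTo (λ i → suc (i + s)) (g ∸ 1)) t∈
... | inj₁ t∈₁ with i , _ , refl ← ∈-applyUpTo⁻ (λ i → suc (i + s)) t∈₁ = s≤s (m≤n+m s i)
... | inj₂ t∈₂ = ≤-<-trans (m≤n+m s g) (gaps-> (g + s) w t∈₂)

gaps-ones : ∀ s n v → gaps s (ones n ++ v) ≡ gaps (n + s) v
gaps-ones s zero v = refl
gaps-ones s (suc n) v = trans (gaps-ones (suc s) n v) (cong (λ s → gaps s v) (+-suc n s))

gaps-++ : ∀ s u v → gaps s (u ++ v) ≡ gaps s u ++ gaps (sum u + s) v
gaps-++ s [] v = refl
gaps-++ s (g ∷ u) v =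
    trans (cong (inner ++_) (trans (gaps-++ (g + s) u v) (cong (λ r → gaps (g + s) u ++ gaps r v) shift)))
  (sym (++-assoc inner (gaps (g + s) u) _))
  where
  inner : List ℕ
  inner = applyUpTo (λ i → suc (i + s)) (g ∸ 1)
  shift : sum u + (g + s) ≡ g + sum u + s
  shift = trans (sym (+-assoc (sum u) g s)) (cong (_+ s) (+-comm (sum u) g))

pts⇒∉gaps : ∀ {s} w {t} → All (0 <_) w → t ∈ pts s w → ¬ t ∈ gaps s w
pts⇒∉gaps (g ∷ w) pos (here refl) t∈ = <-irrefl refl (gaps-> _ (g ∷ w) t∈)
pts⇒∉gaps {s} (suc g ∷ w) {t} (_ ∷ pos) (there t∈) t∈gaps with ∈-++⁻
    (applyUpTo (λ i → suc (i + s)) g) t∈gaps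
... | inj₂ t∈₂ = pts⇒∉gaps w pos (subst (λ p → t ∈ pts p w) (+-comm s (suc g)) t∈) t∈₂
... | inj₁ t∈₁ with i , i<g , refl ← ∈-applyUpTo⁻ (λ i → suc (i + s)) t∈₁ =
  <⇒≱ (≤-trans (s≤s (≤-reflexive (+-comm (suc i) s))) (+-monoʳ-< s (s≤s i<g))) (pts-≥ w t∈)

∉gaps⇒pts : ∀ {s} w {t} → s ≤ t → t ≤ s + sum w → ¬ t ∈ gaps s w → t ∈ pts s w
∉gaps⇒pts {s} [] s≤t t≤ _ = here (≤-antisym (≤-trans t≤ (≤-reflexive (+-identityʳ s))) s≤t)
∉gaps⇒pts {s} (g ∷ w) {t} s≤t t≤ t∉ with m≤n⇒m<n∨m≡n s≤t
... | inj₂ s≡t = here (sym s≡t)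
... | inj₁ s<t with s + g ℕ.≤? t
... | yes s+g≤t = there (∉gaps⇒pts w s+g≤t (≤-trans t≤ (≤-reflexive (sym (+-assoc s g (sum w)))))
  λ t∈ → t∉ (∈-++⁺ʳ _ (subst (λ p → t ∈ gaps p w) (+-comm s g) t∈)))
... | no s+g≰t with i , refl ← m≤n⇒∃[o]m+o≡n s<t =
  ⊥-elim (t∉ (∈-++⁺ˡ (subst (_∈ applyUpTo (λ i → suc (i + s)) (g ∸ 1)) (cong suc (+-comm i s))
    (∈-applyUpTo⁺ (λ i → suc (i + s)) (m+n≤o⇒m≤o∸n (suc i) (subst (_≤ g) (+-comm 1 (suc i))
      (+-cancelˡ-≤ s (suc (suc i)) g
          (≤-trans (≤-reflexive (trans (+-suc s (suc i)) (cong suc (+-suc s i)))) (≰⇒> s+g≰t)))))))))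

Omits : ℕ → ℕ → ℕ → ℕ → List ℕ → Set
Omits m x y z w = ∀ t → t ∈ pts 0 w ⇔ (t ≤ m × t ≢ x × t ≢ y × t ≢ z)

-- Numbers in (sum w, sum w + e] are listed among the omitted ones.
omits : ∀ w e {m x y z} → All (0 <_) w → m ≡ e + sum w →
  gaps 0 w ++ applyUpTo (λ i → suc (i + sum w)) e ≡ x ∷ y ∷ z ∷ [] → Omits m x y z w
omits w e {m} {x} {y} {z} pos refl eq t = mk⇔ to from
  where
  above : List ℕ
  above = applyUpTo (λ i → suc (i + sum w)) e
  pts-≤ : t ∈ pts 0 w → t ≤ sum w
  pts-≤ t∈ with pts-prefix w t∈
  ... | u , v , refl , refl = ≤-trans (m≤m+n (sum u) (sum v)) (≤-reflexive (sym (sum-++ u v)))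
  disjoint : t ∈ pts 0 w → ¬ t ∈ x ∷ y ∷ z ∷ []
  disjoint t∈ t∈xyz with ∈-++⁻ (gaps 0 w) (subst (t ∈_) (sym eq) t∈xyz)
  ... | inj₁ t∈gaps = pts⇒∉gaps w pos t∈ t∈gaps
  ... | inj₂ t∈above with i , _ , refl ← ∈-applyUpTo⁻ (λ i → suc (i + sum w)) t∈above =
    <⇒≱ (s≤s (m≤n+m (sum w) i)) (pts-≤ t∈)
  to : t ∈ pts 0 w → t ≤ e + sum w × t ≢ x × t ≢ y × t ≢ z
  to t∈ = ≤-trans (pts-≤ t∈) (m≤n+m (sum w) e) , (disjoint t∈ ∘ here) , (disjoint t∈ ∘ there ∘ here) ,
    (disjoint t∈ ∘ there ∘ there ∘ here)
  from : t ≤ e + sum w × t ≢ x × t ≢ y × t ≢ z → t ∈ pts 0 w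
  from (t≤ , t≢x , t≢y , t≢z) = ∉gaps⇒pts w z≤n t≤sum (λ t∈ → t∉ (∈-++⁺ˡ t∈))
    where
    t∉ : ¬ t ∈ gaps 0 w ++ above
    t∉ t∈ with subst (t ∈_) eq t∈
    ... | here t≡x = t≢x t≡x
    ... | there (here t≡y) = t≢y t≡y
    ... | there (there (here t≡z)) = t≢z t≡z
    t≤sum : t ≤ sum w
    t≤sum with t ℕ.≤? sum w
    ... | yes p = p
    ... | no t≰ with i , refl ← m≤n⇒∃[o]m+o≡n (≰⇒> t≰) =
      ⊥-elim (t∉ (∈-++⁺ʳ (gaps 0 w) (subst (_∈ above) (cong suc (+-comm i (sum w)))
        (∈-applyUpTo⁺ (λ i → suc (i + sum w)) (+-cancelʳ-≤ (sum w) (suc i) e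
            (≤-trans (≤-reflexive (cong suc (+-comm i (sum w)))) t≤))))))

-- Eliminating ten pairs of ends and reading off the other fourteen.

Exceptional : ℕ → List ℕ → Set
Exceptional k w = ∃ λ x → ∃ λ y → ∃ λ z → ExceptionalTriple k (ℤ.+ x) (ℤ.+ y) (ℤ.+ z) × Omits
    (2 + k) x y z w

private
  plus : ∀ {k x} c → x ≡ c + k → ℤ.+ x ≡ ℤ.+ k ℤ.+ ℤ.+ c
  plus {k} c refl = cong ℤ.+_ (+-comm c k)
  minus : ∀ {k x} c → c + x ≡ k → ℤ.+ x ≡ ℤ.+ k ℤ.- ℤ.+ c
  minus {x = x} c refl = sym (trans (ℤ.m-n≡m⊖n (c + x) c) (trans (ℤ.⊖-≥ (m≤m+n c x))
      (cong ℤ.+_ (m+n∸m≡n c x))))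

-- This is |3^A| ≥ 3k - 5, written with `k = 1 + length w` and without subtraction.
Full : List ℕ → Set
Full w = ∃ λ l → Unique l × All (Sum3 (pts 0 w)) l × 3 * length w ≤ length l + 2

full-reverse : ∀ w → Full w → Full (reverse w)
full-reverse w (l , uniq , S , long) with reflect-sums (reverse w) l uniq
    (subst (λ v → All (Sum3 (pts 0 v)) l) (sym (reverse-involutive w)) S)
... | l′ , len , uniq′ , S′ = l′ , uniq′ , S′ ,
  subst₂ (λ a b → 3 * a ≤ b + 2) (sym (length-reverse w)) (sym len) long

-- Counts the integers of the interval between the extreme 3-sums. The list is non-empty so that the
-- truncated difference `room` is exact.
between : ∀ w s l → Unique (s ∷ l) → All (λ s → low w ≤ s × s + low (reverse w) ≤ 3 * sum w) (s ∷ l) →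
  length (s ∷ l) + (low w + low (reverse w)) ≤ suc (3 * sum w)
between w s l uniq b@((lo , hi) ∷ _) = ≤-trans (+-monoˡ-≤ _ (≤-trans (unique-⊆-length uniq sub)
    (≤-reflexive (length-applyUpTo (low w +_) room))))
  (≤-reflexive (m∸n+n≡m (m≤n⇒m≤1+n (≤-trans (+-monoˡ-≤ _ lo) hi))))
  where
  room : ℕ
  room = suc (3 * sum w) ∸ (low w + low (reverse w))
  sub : ∀ {r} → r ∈ s ∷ l → r ∈ applyUpTo (low w +_) room
  sub {r} r∈ with All.lookup b r∈
  ... | lo , hi with i , refl ← m≤n⇒∃[o]m+o≡n lo =
    ∈-applyUpTo⁺ (low w +_) (m+n≤o⇒m≤o∸n (suc i)
        (≤-trans (≤-reflexive (arith i (low w) (low (reverse w)))) (s≤s hi)))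
    where
    arith : ∀ i a b → suc i + (a + b) ≡ suc (a + i + b)
    arith = solve-∀

-- With `h` holes, the interval of possible sums has `3 * length w + 3 * h + 1` elements minus
-- `low w + low (reverse w)`. The slack `e` allows `l` to contain, besides actual sums, numbers of
-- the interval known not to be sums.
too-many : ∀ w h e l → Unique l → All (λ s → low w ≤ s × s + low (reverse w) ≤ 3 * sum w) l →
  0 < length w → sum w ≡ length w + h → 3 * h + 4 ≤ low w + low (reverse w) + e →
      3 * length w + e ≤ length l + 2 → ⊥
too-many w h e l uniq b w≢[] eq big long with l
... | [] = <⇒≱ (n<1+n 2) (≤-trans (*-monoʳ-≤ 3 w≢[]) (≤-trans (m≤m+n (3 * length w) e) long))
... | s ∷ l′ = <⇒≱ (n<1+n (3 * length w + 3 * h + 3)) (begin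
  suc (3 * length w + 3 * h + 3)               ≡⟨ arith₁ (length w) h ⟩
  3 * length w + (3 * h + 4)                   ≤⟨ +-monoʳ-≤ (3 * length w) big ⟩
  3 * length w + (low w + low (reverse w) + e) ≡⟨ arith₂ (length w) (low w + low (reverse w)) e ⟩
  3 * length w + e + (low w + low (reverse w)) ≤⟨ +-monoˡ-≤ _ long ⟩
  length (s ∷ l′) + 2 + (low w + low (reverse w)) ≡⟨ arith₃ (length (s ∷ l′)) (low w + low (reverse w)) ⟩
  length (s ∷ l′) + (low w + low (reverse w)) + 2 ≤⟨ +-monoˡ-≤ 2 (between w s l′ uniq b) ⟩
  suc (3 * sum w) + 2                          ≡⟨ cong (λ z → suc (3 * z) + 2) eq ⟩
  suc (3 * (length w + h)) + 2                 ≡⟨ arith₄ (length w) h ⟩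
  3 * length w + 3 * h + 3                     ∎)
  where
  open ≤-Reasoning
  arith₁ : ∀ n h → suc (3 * n + 3 * h + 3) ≡ 3 * n + (3 * h + 4)
  arith₁ = solve-∀
  arith₂ : ∀ n c e → 3 * n + (c + e) ≡ 3 * n + e + c
  arith₂ = solve-∀
  arith₃ : ∀ n c → n + 2 + c ≡ n + c + 2
  arith₃ = solve-∀
  arith₄ : ∀ n h → suc (3 * (n + h)) + 2 ≡ 3 * n + 3 * h + 3
  arith₄ = solve-∀

sums-between : ∀ w {l} → All (Sum3 (pts 0 w)) l → All (λ s → low w ≤ s × s + low (reverse w) ≤ 3 * sum w) l
sums-between w = All.map (λ S → low-≤ w S , sum3-≤ w S)

around : List ℕ → ℕ → List ℕ → List ℕ
around u n v = u ++ ones (4 + n) ++ v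

reverse-around : ∀ u n v → reverse (around u n v) ≡ around (reverse v) n (reverse u)
reverse-around u n v = trans (reverse-++₃ u (ones (4 + n)) v)
  (cong (λ r → reverse v ++ r ++ reverse u) (reverse-ones (4 + n)))

sum-excess : ∀ u n v h → sum u + sum v ≡ length u + length v + h → sum (around u n v) ≡ length
    (around u n v) + h
sum-excess u n v h eq = begin
  sum (around u n v)                       ≡⟨ sum-around u (4 + n) v ⟩
  sum u + (sum v + (4 + n))                ≡⟨ +-assoc (sum u) (sum v) (4 + n) ⟨
  sum u + sum v + (4 + n)                  ≡⟨ cong (_+ (4 + n)) eq ⟩
  length u + length v + h + (4 + n)        ≡⟨ arith (length u) (length v) h (4 + n) ⟩
  length u + (length v + (4 + n)) + h      ≡⟨ cong (_+ h) (length-around u (4 + n) v) ⟨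
  length (around u n v) + h                ∎
  where
  open ≡-Reasoning
  arith : ∀ a b h n → a + b + h + n ≡ a + (b + n) + h
  arith = solve-∀

around-nonempty : ∀ u n v → 0 < length (around u n v)
around-nonempty [] n v = s≤s z≤n
around-nonempty (_ ∷ u) n v = s≤s z≤n

not-full : ∀ u n v h → sum u + sum v ≡ length u + length v + h →
  3 * h + 4 ≤ low (around u n v) + low (around (reverse v) n (reverse u)) → ¬ Full (around u n v)
not-full u n v h eq big (l , uniq , S , long) =
  too-many w h 0 l uniq (sums-between w S) (around-nonempty u n v) (sum-excess u n v h eq)
    (subst (3 * h + 4 ≤_) (trans (cong (λ r → low w + low r) (sym (reverse-around u n v)))
        (sym (+-identityʳ _))) big)
    (subst (_≤ length l + 2) (sym (+-identityʳ _)) long)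
  where
  w : List ℕ
  w = around u n v

-- For the left end `1 1 2` the interval alone is one element too large to exclude a full set of
-- sums; this is the element to discard.
4-not-sum : ∀ w → ¬ Sum3 (pts 0 (1 ∷ 1 ∷ 2 ∷ w)) 4
4-not-sum w (_ , _ , _ , _ , _ , here refl , _ , () , _)
4-not-sum w (_ , _ , _ , _ , _ , there (here refl) , () , s≤s z≤n , _)
4-not-sum w (zero , suc zero , _ , _ , _ , there (there (here refl)) , _ , _ , ())
4-not-sum w (suc _ , suc zero , _ , _ , _ , there (there (here refl)) , s≤s () , _ , _)
4-not-sum w (_ , suc (suc _) , _ , _ , _ , there (there (here refl)) , _ , s≤s (s≤s ()) , _)
4-not-sum w (x , suc y , z , _ , _ , there (there (there z∈)) , _ , _ , eq) =
  <⇒≱ (n<1+n 4) (≤-trans (s≤s (pts-≥ w z∈))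
      (≤-trans (≤-trans (s≤s (m≤n+m z y)) (m≤n+m (suc y + z) x)) (≤-reflexive (sym eq))))

-- The points 0, 1, 2, 4, … have excess 2: all sums from 3 up to the greatest occur, except 4.
112-not-full : ∀ n → ¬ Full (around (1 ∷ 1 ∷ 2 ∷ []) n [])
112-not-full n (l , uniq , S , long) =
  too-many w 1 1 (4 ∷ l) (All.map (λ S₁ 4≡s → 4-not-sum (ones (4 + n) ++ []) (subst (Sum3 (pts 0 w))
      (sym 4≡s) S₁)) S ∷ uniq)
    ((≤ᵇ⇒≤ 3 4 _ , 4≤) ∷ sums-between w S) (s≤s z≤n) sum≡
    (≤-reflexive (cong (λ r → 3 + low r + 1) (sym (reverse-around (1 ∷ 1 ∷ 2 ∷ []) n []))))
    (≤-trans (+-monoˡ-≤ 1 long) (≤-reflexive (+-comm (length l + 2) 1)))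
  where
  w : List ℕ
  w = around (1 ∷ 1 ∷ 2 ∷ []) n []
  sum≡ : sum w ≡ length w + 1
  sum≡ = sum-excess (1 ∷ 1 ∷ 2 ∷ []) n [] 1 refl
  4≤ : 4 + low (reverse w) ≤ 3 * sum w
  4≤ = subst (λ r → 4 + low r ≤ 3 * sum w) (sym (reverse-around (1 ∷ 1 ∷ 2 ∷ []) n []))
    (≤-trans (≤ᵇ⇒≤ 7 9 _) (*-monoʳ-≤ 3 {3} {sum w} (s≤s (s≤s (s≤s z≤n)))))

211-not-full : ∀ n → ¬ Full (around [] n (2 ∷ 1 ∷ 1 ∷ []))
211-not-full n F = 112-not-full n (subst Full (reverse-around [] n (2 ∷ 1 ∷ 1 ∷ []))
    (full-reverse (around [] n (2 ∷ 1 ∷ 1 ∷ [])) F))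

-- Of the three omitted integers, `h` are holes and `e` lie above the maximum:
-- `sum w = length w + h` gives `k + 2 = e + sum w`.
found : ∀ u n v h e {x y z} → All (0 <_) (around u n v) →
  sum u + sum v ≡ length u + length v + h → h + e ≡ 3 →
  gaps 0 u ++ gaps (sum u + (4 + n)) v ++ applyUpTo (λ i →
      suc (i + (sum u + (sum v + (4 + n))))) e ≡ x ∷ y ∷ z ∷ [] →
  ExceptionalTriple (suc (length u + (length v + (4 + n)))) (ℤ.+ x) (ℤ.+ y) (ℤ.+ z) →
  Exceptional (suc (length (around u n v))) (around u n v)
found u n v h e {x} {y} {z} pos extra h+e gaps≡ T = x , y , z ,
  subst (λ k → ExceptionalTriple (suc k) (ℤ.+ x) (ℤ.+ y) (ℤ.+ z)) (sym (length-around u (4 + n) v)) T ,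
  omits w e pos max≡ (trans (cong₂ _++_ gaps-w (cong (λ S → applyUpTo (λ i → suc (i + S)) e)
      (sum-around u (4 + n) v)))
    (trans (++-assoc (gaps 0 u) _ _) gaps≡))
  where
  w : List ℕ
  w = around u n v
  max≡ : 3 + length w ≡ e + sum w
  max≡ = trans (cong (_+ length w) (sym h+e)) (trans (arith h e (length w))
      (cong (e +_) (sym (sum-excess u n v h extra))))
    where
    arith : ∀ h e n → h + e + n ≡ e + (n + h)
    arith = solve-∀
  gaps-w : gaps 0 w ≡ gaps 0 u ++ gaps (sum u + (4 + n)) v
  gaps-w = trans (gaps-++ 0 u (ones (4 + n) ++ v)) (cong (gaps 0 u ++_)
      (trans (gaps-ones (sum u + 0) (4 + n) v)
    (cong (λ s → gaps s v) (trans (+-comm (4 + n) (sum u + 0)) (cong (_+ (4 + n)) (+-identityʳ (sum u)))))))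

EndsIn : List ℕ → ℕ → List ℕ → Set
EndsIn u n t = All (0 <_) (around u n t) → Full (around u n t) →
  Exceptional (suc (length (around u n t))) (around u n t)

Outcome : List ℕ × List ℕ → Set
Outcome (u , t) = ∀ n m → m ≡ 0 ⊎ t ≡ 2 ∷ 1 ∷ 1 ∷ 1 ∷ [] → EndsIn u n (t ++ ones m)

at-end : ∀ u t → t ≢ 2 ∷ 1 ∷ 1 ∷ 1 ∷ [] → (∀ n → EndsIn u n t) → Outcome (u , t)
at-end u t _ f n .0 (inj₁ refl) = subst (EndsIn u n) (sym (++-identityʳ t)) (f n)
at-end u t t≢ f n m (inj₂ t≡) = contradiction t≡ t≢

-- The family `{r, k + 1, k + 2}` with `r = 5 + n`; here `k - 4` is `5 + n + m`. The remaining value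
-- `r = 4` comes from the left end `1 1 1 2`.
interior-gap : ∀ n m → All (0 <_) (around [] n (2 ∷ 1 ∷ 1 ∷ 1 ∷ ones m)) →
  Exceptional (suc (length (around [] n (2 ∷ 1 ∷ 1 ∷ 1 ∷ ones m)))) (around [] n (2 ∷ 1 ∷ 1 ∷ 1 ∷ ones m))
interior-gap n m pos = found [] n (2 ∷ 1 ∷ 1 ∷ 1 ∷ ones m) 1 2 pos extra refl
  (cong (λ xs → 5 + n ∷ xs ++ 6 + (sum (ones m) + (4 + n)) ∷ 7 + (sum (ones m) + (4 + n)) ∷ []) no-gaps)
  (inj₂ (inj₂ (inj₂ (inj₂ (inj₂ (inj₂ (inj₂ (inj₂ (inj₂ (inj₂ (inj₂ (inj₂ (ℤ.+ (5 + n) ,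
    ℤ.+≤+ (≤ᵇ⇒≤ 4 (5 + n) _) ,
    subst (ℤ.+ (5 + n) ℤ.≤_) (minus {x = 1 + (length (ones m) + (4 + n))} 4 refl)
        (ℤ.+≤+ (s≤s (m≤n+m (4 + n) (length (ones m))))) ,
    refl , plus 1 (cong (λ s → 6 + (s + (4 + n))) sum≡length) ,
        plus 2 (cong (λ s → 7 + (s + (4 + n))) sum≡length))))))))))))))
  where
  sum≡length : sum (ones m) ≡ length (ones m)
  sum≡length = trans (sum-ones m) (sym (length-replicate m))
  no-gaps : ∀ {s} → gaps s (ones m) ≡ []
  no-gaps {s} = trans (cong (gaps s) (sym (++-identityʳ (ones m)))) (gaps-ones s m [])
  extra : 5 + sum (ones m) ≡ 4 + length (ones m) + 1
  extra = trans (cong (5 +_) sum≡length) (+-comm 1 (4 + length (ones m)))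

-- The entries follow the order of `admissible`. The two numerals passed to `found` count the holes
-- and the omitted integers above the maximum.
outcomes : All Outcome admissible
outcomes =
  at-end [] [] (λ ()) (λ n pos F → ⊥-elim (not-full [] n [] 0 refl (≤ᵇ⇒≤ _ _ _) F)) ∷
  at-end [] (2 ∷ []) (λ ()) (λ n pos F → ⊥-elim (not-full [] n (2 ∷ []) 1 refl (≤ᵇ⇒≤ _ _ _) F)) ∷
  at-end [] (3 ∷ []) (λ ()) (λ n pos F → ⊥-elim (not-full [] n (3 ∷ []) 2 refl (≤ᵇ⇒≤ _ _ _) F)) ∷
  at-end [] (4 ∷ []) (λ ()) (λ n pos F → found [] n (4 ∷ []) 3 0 pos refl refl refl
    (inj₂ (inj₁ (minus 1 refl , refl , plus 1 refl)))) ∷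
  at-end [] (2 ∷ 1 ∷ []) (λ ()) (λ n pos F → ⊥-elim (not-full [] n (2 ∷ 1 ∷ []) 1 refl (≤ᵇ⇒≤ _ _ _) F)) ∷
  at-end [] (2 ∷ 2 ∷ []) (λ ()) (λ n pos F → found [] n (2 ∷ 2 ∷ []) 2 1 pos refl refl refl
    (inj₂ (inj₂ (inj₂ (inj₂ (inj₂ (inj₁ (minus 2 refl , refl , plus 2 refl)))))))) ∷
  at-end [] (2 ∷ 1 ∷ 1 ∷ []) (λ ()) (λ n pos F → ⊥-elim (211-not-full n F)) ∷
  at-end [] (2 ∷ 1 ∷ 2 ∷ []) (λ ()) (λ n pos F → found [] n (2 ∷ 1 ∷ 2 ∷ []) 2 1 pos refl refl refl
    (inj₂ (inj₂ (inj₂ (inj₂ (inj₂ (inj₂ (inj₂ (inj₁ (minus 3 refl , refl , plus 2 refl)))))))))) ∷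
  (λ n m _ pos F → interior-gap n m pos) ∷
  at-end (2 ∷ []) [] (λ ()) (λ n pos F → ⊥-elim (not-full (2 ∷ []) n [] 1 refl (≤ᵇ⇒≤ _ _ _) F)) ∷
  at-end (2 ∷ []) (2 ∷ []) (λ ()) (λ n pos F → ⊥-elim (not-full (2 ∷ []) n (2 ∷ []) 2 refl
      (≤ᵇ⇒≤ _ _ _) F)) ∷
  at-end (2 ∷ []) (3 ∷ []) (λ ()) (λ n pos F → found (2 ∷ []) n (3 ∷ []) 3 0 pos refl refl refl
    (inj₂ (inj₂ (inj₂ (inj₁ (refl , refl , plus 1 refl)))))) ∷
  at-end (2 ∷ []) (2 ∷ 1 ∷ []) (λ ()) (λ n pos F → found (2 ∷ []) n (2 ∷ 1 ∷ []) 2 1 pos refl refl refl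
    (inj₂ (inj₂ (inj₂ (inj₂
        (inj₂ (inj₂ (inj₂ (inj₂ (inj₂ (inj₁ (refl , minus 1 refl , plus 2 refl)))))))))))) ∷
  at-end (2 ∷ []) (2 ∷ 1 ∷ 1 ∷ []) (λ ()) (λ n pos F → found (2 ∷ []) n
      (2 ∷ 1 ∷ 1 ∷ []) 2 1 pos refl refl refl
    (inj₂ (inj₂ (inj₂ (inj₂
        (inj₂ (inj₂ (inj₂ (inj₂ (inj₂ (inj₂ (inj₁ (refl , minus 2 refl , plus 2 refl))))))))))))) ∷
  at-end (3 ∷ []) [] (λ ()) (λ n pos F → ⊥-elim (not-full (3 ∷ []) n [] 2 refl (≤ᵇ⇒≤ _ _ _) F)) ∷
  at-end (3 ∷ []) (2 ∷ []) (λ ()) (λ n pos F → found (3 ∷ []) n (2 ∷ []) 3 0 pos refl refl refl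
    (inj₂ (inj₂ (inj₁ (refl , refl , plus 1 refl))))) ∷
  at-end (4 ∷ []) [] (λ ()) (λ n pos F → found (4 ∷ []) n [] 3 0 pos refl refl refl
    (inj₁ (refl , refl , refl))) ∷
  at-end (1 ∷ 2 ∷ []) [] (λ ()) (λ n pos F → ⊥-elim (not-full (1 ∷ 2 ∷ []) n [] 1 refl (≤ᵇ⇒≤ _ _ _) F)) ∷
  at-end (1 ∷ 2 ∷ []) (2 ∷ []) (λ ()) (λ n pos F → found (1 ∷ 2 ∷ []) n (2 ∷ []) 2 1 pos refl refl refl
    (inj₂ (inj₂ (inj₂ (inj₂ (inj₂ (inj₂ (inj₂ (inj₂ (inj₁ (refl , refl , plus 2 refl))))))))))) ∷
  at-end (2 ∷ 2 ∷ []) [] (λ ()) (λ n pos F → found (2 ∷ 2 ∷ []) n [] 2 1 pos refl refl refl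
    (inj₂ (inj₂ (inj₂ (inj₂ (inj₁ (refl , refl , plus 2 refl))))))) ∷
  at-end (1 ∷ 1 ∷ 2 ∷ []) [] (λ ()) (λ n pos F → ⊥-elim (112-not-full n F)) ∷
  at-end (1 ∷ 1 ∷ 2 ∷ []) (2 ∷ []) (λ ()) (λ n pos F → found (1 ∷ 1 ∷ 2 ∷ []) n
      (2 ∷ []) 2 1 pos refl refl refl
    (inj₂ (inj₂ (inj₂ (inj₂
        (inj₂ (inj₂ (inj₂ (inj₂ (inj₂ (inj₂ (inj₂ (inj₁ (refl , refl , plus 2 refl)))))))))))))) ∷
  at-end (2 ∷ 1 ∷ 2 ∷ []) [] (λ ()) (λ n pos F → found (2 ∷ 1 ∷ 2 ∷ []) n [] 2 1 pos refl refl refl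
    (inj₂ (inj₂ (inj₂ (inj₂ (inj₂ (inj₂ (inj₁ (refl , refl , plus 2 refl))))))))) ∷
  at-end (1 ∷ 1 ∷ 1 ∷ 2 ∷ []) [] (λ ()) (λ n pos F → found (1 ∷ 1 ∷ 1 ∷ 2 ∷ []) n [] 1 2 pos refl refl refl
    (inj₂ (inj₂ (inj₂ (inj₂ (inj₂ (inj₂ (inj₂ (inj₂ (inj₂ (inj₂ (inj₂ (inj₂ (
      ℤ.+ 4 , ℤ.≤-refl , subst (ℤ.+ 4 ℤ.≤_) (minus {x = 5 + n} 4 refl) (ℤ.+≤+ (≤ᵇ⇒≤ 4 (5 + n) _)) ,
      refl , plus 1 refl , plus 2 refl)))))))))))))) ∷
  []

exceptional : ∀ w → Excess≤ 3 w → 10 ≤ length w → Primitive w → Full w → Exceptional (suc (length w)) w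
exceptional w e len prim F = ends⇒ (classification w e len prim)
  where
  ends⇒ : Ends w → Exceptional (suc (length w)) w
  ends⇒ (u , n , t , m , ut∈ , long , refl) = All.lookup outcomes ut∈ n m long (positive e) F

-- From lists of integers to gap words and back.

gap-word : ∀ b bs → AllPairs _<_ (b ∷ bs) → ∃ λ w → All (0 <_) w × pts b w ≡ b ∷ bs
gap-word b [] _ = [] , [] , refl
gap-word b (c ∷ cs) ((b<c ∷ _) ∷ inc) with gap-word c cs inc
... | w , pos , eq = c ∸ b ∷ w , m<n⇒0<n∸m b<c ∷ pos ,
  cong (b ∷_) (trans (cong (λ s → pts s w) (m+[n∸m]≡n (<⇒≤ b<c))) eq)

length-pts : ∀ s w → length (pts s w) ≡ suc (length w)
length-pts s [] = refl
length-pts s (g ∷ w) = cong suc (length-pts (s + g) w)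

sort-increasing : ∀ {xs} → Unique xs → AllPairs _<_ (sort xs)
sort-increasing {xs} uniq = AllPairs.zipWith (λ (x≤y , x≢y) → ≤∧≢⇒< x≤y x≢y)
  (Linked⇒AllPairs ≤-trans (sort-↗ xs) , Permutation.Unique-resp-↭ (setoid ℕ)
      (↭⇒↭ₛ (↭-sym (sort-↭ xs))) uniq)

starts-at-0 : ∀ ys → AllPairs _<_ ys → 0 ∈ ys → ∃ λ w → All (0 <_) w × pts 0 w ≡ ys
starts-at-0 (_ ∷ ys) inc (here refl) = gap-word 0 ys inc
starts-at-0 (y ∷ ys) (y< ∷ _) (there 0∈) = contradiction (All.lookup y< 0∈) n≮0

encode : ∀ {xs} → Unique xs → 0 ∈ xs → ∃ λ w → All (0 <_) w × pts 0 w ↭ xs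
encode {xs} uniq 0∈ with starts-at-0 (sort xs) (sort-increasing uniq) (∈-resp-↭ (↭-sym (sort-↭ xs)) 0∈)
... | w , pos , eq = w , pos , subst (_↭ xs) (sym eq) (sort-↭ xs)

sum3-distinct : ∀ {P x y z} → x ∈ P → y ∈ P → z ∈ P → x ≢ y → x ≢ z → y ≢ z → Sum3 P (x + y + z)
sum3-distinct {x = x} {y} {z} x∈ y∈ z∈ x≢y x≢z y≢z with <-cmp x y | <-cmp y z | <-cmp x z
... | tri≈ _ x≡y _ | _ | _ = contradiction x≡y x≢y
... | _ | tri≈ _ y≡z _ | _ = contradiction y≡z y≢z
... | _ | _ | tri≈ _ x≡z _ = contradiction x≡z x≢z
... | tri< x<y _ _ | tri< y<z _ _ | _ = x , y , z , x∈ , y∈ , z∈ , x<y , y<z , arith x y z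
  where
  arith : ∀ x y z → x + y + z ≡ x + (y + z)
  arith = solve-∀
... | tri< _ _ _ | tri> _ _ z<y | tri< x<z _ _ = x , z , y , x∈ , z∈ , y∈ , x<z , z<y , arith x y z
  where
  arith : ∀ x y z → x + y + z ≡ x + (z + y)
  arith = solve-∀
... | tri< x<y _ _ | tri> _ _ z<y | tri> _ _ z<x = z , x , y , z∈ , x∈ , y∈ , z<x , x<y , arith x y z
  where
  arith : ∀ x y z → x + y + z ≡ z + (x + y)
  arith = solve-∀
... | tri> _ _ y<x | tri< _ _ _ | tri< x<z _ _ = y , x , z , y∈ , x∈ , z∈ , y<x , x<z , arith x y z
  where
  arith : ∀ x y z → x + y + z ≡ y + (x + z)
  arith = solve-∀
... | tri> _ _ y<x | tri< y<z _ _ | tri> _ _ z<x = y , z , x , y∈ , z∈ , x∈ , y<z , z<x , arith x y z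
  where
  arith : ∀ x y z → x + y + z ≡ y + (z + x)
  arith = solve-∀
... | tri> _ _ y<x | tri> _ _ z<y | _ = z , y , x , z∈ , y∈ , x∈ , z<y , y<x , arith x y z
  where
  arith : ∀ x y z → x + y + z ≡ z + (y + x)
  arith = solve-∀

·-divides : ∀ d z → All (d ∣_) (d · z)
·-divides d [] = []
·-divides d (x ∷ z) = n∣m*n x ∷ ·-divides d z

sum-divides : ∀ {d} u → All (d ∣_) u → d ∣ sum u
sum-divides {d} [] [] = d ∣0
sum-divides (x ∷ u) (d∣x ∷ d∣u) = ∣m∣n⇒∣m+n d∣x (sum-divides u d∣u)

pts-divides : ∀ d z {t} → t ∈ pts 0 (d · z) → d ∣ t
pts-divides d z t∈ with pts-prefix (d · z) t∈
... | u , v , eq , refl = sum-divides u (All.++⁻ˡ u (subst (All (d ∣_)) eq (·-divides d z)))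

gcdList-greatest : ∀ d A → All (λ a → d ∣ ∣ a ∣) A → d ∣ ∣ gcdList A ∣
gcdList-greatest d [] [] = d ∣0
gcdList-greatest d (a ∷ A) (d∣a ∷ d∣A) = gcd-greatest {a} {gcdList A} {ℤ.+ d} d∣a (gcdList-greatest d A d∣A)

module _ {A : List ℤ} (uniqA : Unique A) (0∈A : ℤ.+ 0 ∈ A) (A≥0 : All (ℤ.+ 0 ℤ.≤_) A) where

  +∣∣ : ∀ {a} → a ∈ A → ℤ.+ ∣ a ∣ ≡ a
  +∣∣ a∈ = ℤ.0≤i⇒+∣i∣≡i (All.lookup A≥0 a∈)

  ∣∣-injective : ∀ {a b} → ℤ.+ ∣ a ∣ ≡ a → ℤ.+ ∣ b ∣ ≡ b → ∣ a ∣ ≡ ∣ b ∣ → a ≡ b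
  ∣∣-injective a≡ b≡ eq = trans (sym a≡) (trans (cong ℤ.+_ eq) b≡)

  encodeℤ : ∃ λ w → All (0 <_) w × suc (length w) ≡ length A × (∀ t → t ∈ pts 0 w ⇔ ℤ.+ t ∈ A)
  encodeℤ with encode (unique-map (λ a∈ b∈ → ∣∣-injective (+∣∣ a∈) (+∣∣ b∈)) uniqA) (∈-map⁺ ∣_∣ 0∈A)
  ... | w , pos , perm = w , pos ,
    trans (sym (length-pts 0 w)) (trans (↭-length perm) (length-map ∣_∣ A)) , λ t → mk⇔ (to t) (from t)
    where
    to : ∀ t → t ∈ pts 0 w → ℤ.+ t ∈ A
    to t t∈ with ∈-map⁻ ∣_∣ (∈-resp-↭ perm t∈)
    ... | a , a∈ , refl = subst (_∈ A) (sym (+∣∣ a∈)) a∈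
    from : ∀ t → ℤ.+ t ∈ A → t ∈ pts 0 w
    from t t∈ = ∈-resp-↭ (↭-sym perm) (∈-map⁺ ∣_∣ t∈)

  module _ {w : List ℕ} (pts⇔ : ∀ t → t ∈ pts 0 w ⇔ ℤ.+ t ∈ A) where

    restricted⇒sum3 : ∀ {s} → InRestricted3Sum A s → ∃ λ t → s ≡ ℤ.+ t × Sum3 (pts 0 w) t
    restricted⇒sum3 (a , b , c , a∈ , b∈ , c∈ , a≢b , a≢c , b≢c , refl) =
      ∣ a ∣ + ∣ b ∣ + ∣ c ∣ ,
      sym (cong₂ ℤ._+_ (cong₂ ℤ._+_ (+∣∣ a∈) (+∣∣ b∈)) (+∣∣ c∈)) ,
      sum3-distinct (pt a∈) (pt b∈) (pt c∈) (a≢b ∘ inj a∈ b∈) (a≢c ∘ inj a∈ c∈) (b≢c ∘ inj b∈ c∈)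
      where
      pt : ∀ {a} → a ∈ A → ∣ a ∣ ∈ pts 0 w
      pt a∈ = Equivalence.from (pts⇔ _) (subst (_∈ A) (sym (+∣∣ a∈)) a∈)
      inj : ∀ {a b} → a ∈ A → b ∈ A → ∣ a ∣ ≡ ∣ b ∣ → a ≡ b
      inj a∈ b∈ = ∣∣-injective (+∣∣ a∈) (+∣∣ b∈)

    sum3⇒restricted : ∀ {t} → Sum3 (pts 0 w) t → InRestricted3Sum A (ℤ.+ t)
    sum3⇒restricted (x , y , z , x∈ , y∈ , z∈ , x<y , y<z , refl) =
      ℤ.+ x , ℤ.+ y , ℤ.+ z , Equivalence.to (pts⇔ x) x∈ , Equivalence.to (pts⇔ y) y∈ ,
          Equivalence.to (pts⇔ z) z∈ ,
      <⇒≢ x<y ∘ ℤ.+-injective , <⇒≢ (<-trans x<y y<z) ∘ ℤ.+-injective , <⇒≢ y<z ∘ ℤ.+-injective ,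
      cong ℤ.+_ (sym (+-assoc x y z))

    module _ {L : List ℤ} (uniqL : Unique L) (L⇔ : ∀ s → s ∈ L ⇔ InRestricted3Sum A s) where

      card⇒excess : ∀ {j} → All (0 <_) w → length L + 5 ≤ 3 * length w + j → Excess≤ j w
      card⇒excess pos L≤ = excess≤ pos λ l uniq S → ≤-trans (+-monoˡ-≤ 5 (bounded l uniq S)) L≤
        where
        bounded : ∀ l → Unique l → All (Sum3 (pts 0 w)) l → length l ≤ length L
        bounded l uniq S = ≤-trans (≤-reflexive (sym (length-map ℤ.+_ l)))
          (unique-⊆-length (Unique.map⁺ ℤ.+-injective uniq) sub)
          where
          sub : ∀ {s} → s ∈ map ℤ.+_ l → s ∈ L
          sub s∈ with ∈-map⁻ ℤ.+_ s∈
          ... | t , t∈ , refl = Equivalence.from (L⇔ (ℤ.+ t)) (sum3⇒restricted (All.lookup S t∈))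

      card⇒full : 3 * length w ≤ length L + 2 → Full w
      card⇒full ≤L = map ∣_∣ L ,
        unique-map (λ s∈ r∈ → ∣∣-injective (nonneg s∈) (nonneg r∈)) uniqL ,
        All.map⁺ (All.tabulate is-sum) ,
        ≤-trans ≤L (≤-reflexive (cong (_+ 2) (sym (length-map ∣_∣ L))))
        where
        nonneg : ∀ {s} → s ∈ L → ℤ.+ ∣ s ∣ ≡ s
        nonneg s∈ with restricted⇒sum3 (Equivalence.to (L⇔ _) s∈)
        ... | t , refl , _ = refl
        is-sum : ∀ {s} → s ∈ L → Sum3 (pts 0 w) ∣ s ∣
        is-sum s∈ with restricted⇒sum3 (Equivalence.to (L⇔ _) s∈)
        ... | t , refl , S = S

    -- As the minimum is 0, every element is a sum of gaps, and a common divisor of the gaps divides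
    -- them all.
    gcd⇒primitive : gcdList A ≡ ℤ.+ 1 → Primitive w
    gcd⇒primitive gcd≡1 d z refl = ∣1⇒≡1 (subst (λ g → d ∣ ∣ g ∣) gcd≡1 (gcdList-greatest d A
        (All.tabulate divides)))
      where
      divides : ∀ {a} → a ∈ A → d ∣ ∣ a ∣
      divides a∈ = pts-divides d z (Equivalence.from (pts⇔ _) (subst (_∈ A) (sym (+∣∣ a∈)) a∈))

    omits⇒interval : ∀ {k x y z} → Omits (2 + k) x y z w →
      IsIntervalMinus3 A (ℤ.+ k ℤ.+ ℤ.+ 2) (ℤ.+ x) (ℤ.+ y) (ℤ.+ z)
    omits⇒interval {k} {x} {y} {z} omits t = mk⇔ to from
      where
      Bounds : ℤ → Set
      Bounds t = ℤ.+ 0 ℤ.≤ t × t ℤ.≤ ℤ.+ (k + 2) × t ≢ ℤ.+ x × t ≢ ℤ.+ y × t ≢ ℤ.+ z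
      bounds : ∀ {t} → t ∈ pts 0 w → Bounds (ℤ.+ t)
      bounds {t} t∈ with t≤ , t≢x , t≢y , t≢z ← Equivalence.to (omits t) t∈ =
        ℤ.+≤+ z≤n , ℤ.+≤+ (≤-trans t≤ (≤-reflexive (+-comm 2 k))) ,
        t≢x ∘ ℤ.+-injective , t≢y ∘ ℤ.+-injective , t≢z ∘ ℤ.+-injective
      to : t ∈ A → Bounds t
      to t∈ = subst Bounds (+∣∣ t∈)
          (bounds (Equivalence.from (pts⇔ ∣ t ∣) (subst (_∈ A) (sym (+∣∣ t∈)) t∈)))
      from : Bounds t → t ∈ A
      from (ℤ.+≤+ {n = t} _ , t≤ , t≢x , t≢y , t≢z) = Equivalence.to (pts⇔ t) (Equivalence.from (omits t)
        (≤-trans (ℤ.drop‿+≤+ t≤) (≤-reflexive (+-comm k 2)) , (λ eq → t≢x (cong ℤ.+_ eq)) ,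
            (λ eq → t≢y (cong ℤ.+_ eq)) , (λ eq → t≢z (cong ℤ.+_ eq))))

theorem1p13 : (k : ℕ) → 13 ℕ.≤ k → (A : List ℤ) → Unique A → length A ≡ k →
    MinIsZero A → gcdList A ≡ ℤ.+ 1 → Restricted3SumCard A (3 ℕ.* k ℕ.∸ 5) →
    Σ ℤ λ x → Σ ℤ λ y → Σ ℤ λ z →
      ExceptionalTriple k x y z × IsIntervalMinus3 A (ℤ.+ k ℤ.+ ℤ.+ 2) x y z
theorem1p13 k 13≤k A uniq refl (0∈A , A≥0) gcd≡1 (L , uniqL , lenL , L⇔) with encodeℤ uniq 0∈A A≥0
... | w , pos , len , pts⇔ = conclude (exceptional w
    (card⇒excess uniq 0∈A A≥0 pts⇔ uniqL L⇔ pos (≤-reflexive L+5≡))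
    (≤-trans (≤ᵇ⇒≤ 10 12 _) 12≤w)
    (gcd⇒primitive uniq 0∈A A≥0 pts⇔ gcd≡1)
    (card⇒full uniq 0∈A A≥0 pts⇔ uniqL L⇔ (+-cancelʳ-≤ 3 (3 * length w) _ (≤-reflexive
        (trans (sym L+5≡) (sym (+-assoc _ 2 3)))))))
  where
  12≤w : 12 ≤ length w
  12≤w = ≤-pred (≤-trans 13≤k (≤-reflexive (sym len)))
  -- With `k = length w + 1` this is `|L| = 3 * k - 5`, the truncated subtraction being exact for
  -- such `k`. Read as an upper bound it gives excess at most 3, read as a lower bound it gives
  -- `Full w`.
  L+5≡ : length L + 5 ≡ 3 * length w + 3
  L+5≡ = trans (cong (_+ 5) lenL) (trans (m∸n+n≡m (≤-trans (≤ᵇ⇒≤ 5 39 _) (*-monoʳ-≤ 3 13≤k)))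
      (trans (cong (3 *_) (sym len)) (arith (length w))))
    where
    arith : ∀ n → 3 * suc n ≡ 3 * n + 3
    arith = solve-∀
  conclude : Exceptional (suc (length w)) w → Σ ℤ λ x → Σ ℤ λ y → Σ ℤ λ z →
    ExceptionalTriple (length A) x y z × IsIntervalMinus3 A (ℤ.+ length A ℤ.+ ℤ.+ 2) x y z
  conclude E with x , y , z , T , omits ← subst (λ k → Exceptional k w) len E =
    ℤ.+ x , ℤ.+ y , ℤ.+ z , T , omits⇒interval uniq 0∈A A≥0 pts⇔ omits
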